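{- The map $\delta^\circ$ is a bijection from $B_n$ to the set of type-B noncrossing arc diagrams on $n$ points.
   Context: $B_n$: signed permutations of $\{\pm1,\ldots,\pm n\}$ ($\pi(-i)=-\pi(i)$), long one-line notation $\pi_{ -n}\cdots\pi_{ -1}\pi_1\cdots\pi_n$. Symmetric model: $2n$ points on a vertical line labeled $-n,\ldots,-1,1,\ldots,n$ bottom to top, symmetric under the half-turn $x\mapsto -x$ about the origin. An arc: monotone downward curve between labeled points, touching no other labeled point, passing left or right of those between. For $\pi\in B_n$, $\delta(\pi)$ has, for each pair of consecutive positions $a,b$ (order $-n<\cdots<-1<1<\cdots<n$) with $\pi_a>\pi_b$, an arc from $\pi_a$ down to $\pi_b$ passing right of each $\pi_c$ with $\pi_b<\pi_c<\pi_a$, $c$ before $a$, and left of such $\pi_c$ with $c$ after $b$; $\delta(\pi)$ is a centrally symmetric set of non-crossing arcs, a union of symmetric arcs (fixed by the half-turn) and symmetric pairs $\{\alpha,-\alpha\}$. Orbifold model: the orbifold plane is $\mathbb R^2$ modulo $x\sim -x$, pictured as the open upper half-plane together with, for each $r\ge 0$, one "semicircle point" (the closed lower semicircle of radius $r$ about the origin; $r=0$ is the orbifold point $\times$). Numbered points $1,\ldots,n$ lie on the vertical axis above $\times$, in increasing order upward. A type-B arc is one of: an ordinary arc (a curve from numbered $q$ monotone downward to numbered $p<q$, touching no other numbered point, passing left or right of each point between); an orbifold arc (a curve monotone downward from a numbered point $p$ to $\times$, passing left or right of each of $1,\ldots,p-1$); a long arc (a curve containing exactly one semicircle point, which is not $\times$,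 consisting of a left piece descending monotonically from its left endpoint $p$ to the left end of that semicircle and a right piece descending from its right endpoint $q\ne p$ to its right end, the pieces disjoint, each passing left or right of the numbered points below its endpoint). Arcs are up to combinatorial equivalence. A type-B noncrossing arc diagram is a set of type-B arcs that pairwise do not intersect except possibly at numbered endpoints, with no two arcs sharing an endpoint from which both go downward or both go upward. Let $\phi$ map the plane to the orbifold plane: points strictly above the horizontal axis map to themselves, points strictly below map to their negatives, and a point $x$ on the horizontal axis maps to the semicircle point of radius $|x|$. $\phi$ sends each symmetric arc (endpoints $\pm p$) to an orbifold arc with upper endpoint $p$, each non-overlapping symmetric pair to an ordinary arc, and each overlapping symmetric pair to a long arc. Define $\delta^\circ(\pi)=\phi(\delta(\pi))$, a set of type-B arcs. -}

module Defs where

open import Data.Bool using (Bool; true; false; if_then_else_)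
open import Data.Nat using (ℕ; zero; suc; _∸_; _⊔_; _⊓_; _≡ᵇ_; _<ᵇ_)
  renaming (_≤_ to _≤ℕ_; _<_ to _<ℕ_; _+_ to _+ℕ_)
open import Data.Integer using (ℤ; +_; -_; ∣_∣; 0ℤ; _≟_; _<?_)
  renaming (_<_ to _<ℤ_)
open import Data.List using (List; []; _∷_; _++_; map; length; reverse; upTo)
open import Data.Bool.ListAction using (any)
open import Data.List.Membership.Propositional using (_∈_)
open import Data.List.Relation.Unary.All using (All)
open import Data.List.Relation.Unary.AllPairs using (AllPairs)
open import Data.List.Relation.Unary.Unique.Propositional using (Unique)
open import Data.Product using (_×_; _,_; Σ; ∃; proj₁)
open import Data.Unit using (⊤)
open import Data.Empty using (⊥)
open import Relation.Nullary using (¬_; does)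
open import Relation.Binary.PropositionalEquality using (_≡_; _≢_)

IsSignedPerm : ℕ → List ℤ → Set
IsSignedPerm n π =
  length π ≡ n
  × All (λ z → (z ≢ 0ℤ) × (∣ z ∣ ≤ℕ n)) π
  × Unique (map ∣_∣ π)

-- long one-line notation π_{-n} ⋯ π_{-1} π_1 ⋯ π_n, with π_{-i} = -π_i
longWord : List ℤ → List ℤ
longWord π = reverse (map -_ π) ++ π

data Side : Set where
  L R : Side

flipSide : Side → Side
flipSide L = R
flipSide R = L

isL : Side → Bool
isL L = true
isL R = false

-- Arcs of the symmetric model (labels ±1,…,±n on a vertical line).
-- An arc from label 'top' down to label 'bot' (top > bot); 'side v'
-- is the side on which it passes the label v, for each label v with
-- bot < v < top, v ≠ 0 (values at other v are irrelevant).

record SArc : Set where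
  constructor sarc
  field
    top  : ℤ
    bot  : ℤ
    side : ℤ → Side

memℤ : ℤ → List ℤ → Bool
memℤ v xs = any (λ z → does (v ≟ z)) xs

-- descents pre w : arcs for the consecutive pairs of w (pre = the
-- entries to the left of w in the long one-line notation).  For a
-- descent π_a > π_b the arc passes RIGHT of π_c when c is before a and
-- LEFT of π_c when c is after b.
descents : List ℤ → List ℤ → List SArc
descents pre [] = []
descents pre (x ∷ []) = []
descents pre (x ∷ y ∷ rest) =
  (if does (y <? x)
     then sarc x y (λ v → if memℤ v pre then R else L) ∷ []
     else [])
  ++ descents (pre ++ x ∷ []) (y ∷ rest)

δ : List ℤ → List SArc
δ π = descents [] (longWord π)

-- Type-B arcs in the orbifold plane, up to combinatorial equivalence.

data BArc : Set where
  -- ordinary p q s : from q down to p (p < q); s lists the sides at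
  -- the points p+1, …, q-1 (bottom to top)
  ordinary : ℕ → ℕ → List Side → BArc
  -- orbifold p s : from p down to ×; s lists the sides at 1, …, p-1
  orbifold : ℕ → List Side → BArc
  -- long l r sl sr : left piece from l, right piece from r (l ≠ r);
  -- sl (resp. sr) lists the sides of the left (right) piece at the
  -- points 1, …, l-1 (resp. 1, …, r-1)
  long : ℕ → ℕ → List Side → List Side → BArc

between : ℕ → ℕ → List ℕ
between p q = map (λ i → suc (p +ℕ i)) (upTo (q ∸ p ∸ 1))

-- The map φ (folding the plane onto the orbifold plane), applied to an
-- arc α of δ(π); the image of a symmetric pair {α,-α} is φ(α) = φ(-α).
-- Points above the axis are kept, points below are negated (which
-- exchanges left and right).  For an overlapping pair, the piece of
-- φ(α) that is the upper part of α is the left piece iff α is to the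
-- left of -α where they cross the axis; since α and -α are disjoint
-- this is read off from the side of α at the point where the shorter
-- of the two upper pieces ends.

φ : SArc → BArc
φ (sarc a b s) =
  if does (0ℤ <? b) then ordinary B A (map (λ h → s (+ h)) (between B A))
  else if does (a <? 0ℤ) then ordinary A B (map (λ h → flipSide (s (- (+ h)))) (between A B))
  else mixed
  where
  A = ∣ a ∣
  B = ∣ b ∣
  Us = map (λ h → s (+ h)) (between 0 A)
  Ns = map (λ h → flipSide (s (- (+ h)))) (between 0 B)
  uLeft : Bool
  uLeft = if B <ᵇ A then isL (s (+ B)) else isL (s (- (+ A)))
  mixed : BArc
  mixed = if A ≡ᵇ B then orbifold A Us
          else (if uLeft then long A B Us Ns else long B A Ns Us)

δ° : List ℤ → List BArc
δ° π = map φ (δ π)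

-- Drawings.  A type-B arc is cut into "strands", each a curve in the
-- closed upper half-plane that is monotone in the height.  A drawing of
-- a strand records its x-coordinate at each integer height in its range
-- (the curve is the piecewise-linear interpolation); every drawing of a
-- monotone curve is combinatorially equivalent to such a one.

data BotKind : Set where
  numbered axisLeft axisCenter axisRight : BotKind

record Strand : Set where
  constructor strand
  field
    top   : ℕ
    bot   : ℕ
    sides : List Side   -- sides at heights bot+1, …, top-1
    kind  : BotKind

strands : BArc → List Strand
strands (ordinary p q s)   = strand q p s numbered ∷ []
strands (orbifold p s)     = strand p 0 s axisCenter ∷ []
strands (long l r sl sr)   = strand l 0 sl axisLeft ∷ strand r 0 sr axisRight ∷ []

sideAt : List Side → ℕ → Side
sideAt [] _ = L
sideAt (x ∷ xs) zero = x
sideAt (x ∷ xs) (suc i) = sideAt xs i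

SideOK : Side → ℤ → Set
SideOK L x = x <ℤ 0ℤ
SideOK R x = 0ℤ <ℤ x

-- bottom position; ρ is the radius of the semicircle point of the arc
BotOK : BotKind → ℕ → ℤ → Set
BotOK numbered   ρ x = x ≡ 0ℤ
BotOK axisLeft   ρ x = x ≡ - (+ ρ)
BotOK axisCenter ρ x = x ≡ 0ℤ
BotOK axisRight  ρ x = x ≡ + ρ

IsAxis : BotKind → Set
IsAxis numbered = ⊥
IsAxis _ = ⊤

DStrand : Set
DStrand = Strand × (ℕ → ℤ)

Fits : ℕ → DStrand → Set
Fits ρ ((strand t b s k) , f) =
  f t ≡ 0ℤ
  × (∀ h → b <ℕ h → h <ℕ t → SideOK (sideAt s (h ∸ b ∸ 1)) (f h))
  × BotOK k ρ (f b)

-- two drawn strands do not meet in the open upper half-plane except at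
-- numbered points (which then are endpoints of both), and never pass
-- each other between consecutive integer heights
Disj : DStrand → DStrand → Set
Disj ((strand t₁ b₁ _ _) , f) ((strand t₂ b₂ _ _) , g) =
  ∀ h → (b₁ ⊔ b₂) ≤ℕ h → h ≤ℕ (t₁ ⊓ t₂) →
    (1 ≤ℕ h → f h ≡ g h → f h ≡ 0ℤ)
    × (suc h ≤ℕ (t₁ ⊓ t₂) → f h ≢ g h → f (suc h) ≢ g (suc h) →
        (f h <ℤ g h → f (suc h) <ℤ g (suc h))
        × (g h <ℤ f h → g (suc h) <ℤ f (suc h)))

-- strands of two different arcs reaching the axis must reach it at
-- different orbifold points (the points (±r,0) are one semicircle point)
AxisOK : DStrand → DStrand → Set
AxisOK ((strand _ _ _ k₁) , f) ((strand _ _ _ k₂) , g) =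
  IsAxis k₁ → IsAxis k₂ → ∣ f 0 ∣ ≢ ∣ g 0 ∣

RadiusOK : BArc → ℕ → Set
RadiusOK (long _ _ _ _) ρ = 1 ≤ℕ ρ      -- the semicircle point is not ×
RadiusOK _ ρ = ⊤

Draw : BArc → ℕ → List DStrand → Set
Draw A ρ D =
  map proj₁ D ≡ strands A × RadiusOK A ρ × All (Fits ρ) D × AllPairs Disj D

ValidArc : ℕ → BArc → Set
ValidArc n (ordinary p q s) =
  1 ≤ℕ p × p <ℕ q × q ≤ℕ n × length s ≡ q ∸ p ∸ 1
ValidArc n (orbifold p s) =
  1 ≤ℕ p × p ≤ℕ n × length s ≡ p ∸ 1
ValidArc n A@(long l r sl sr) =
  1 ≤ℕ l × l ≤ℕ n × 1 ≤ℕ r × r ≤ℕ n × l ≢ r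
  × length sl ≡ l ∸ 1 × length sr ≡ r ∸ 1
  × Σ ℕ (λ ρ → Σ (List DStrand) (λ D → Draw A ρ D))   -- pieces disjoint

NonCrossing : BArc → BArc → Set
NonCrossing A B =
  Σ ℕ λ ρA → Σ (List DStrand) λ DA → Σ ℕ λ ρB → Σ (List DStrand) λ DB →
    Draw A ρA DA × Draw B ρB DB
    × All (λ x → All (λ y → Disj x y × AxisOK x y) DB) DA

-- endpoints from which the arc goes downward / upward
downEnds : BArc → List ℕ
downEnds (ordinary p q _) = q ∷ []
downEnds (orbifold p _)   = p ∷ []
downEnds (long l r _ _)   = l ∷ r ∷ []

upEnds : BArc → List ℕ
upEnds (ordinary p q _) = p ∷ []
upEnds (orbifold _ _)   = []
upEnds (long _ _ _ _)   = []

DisjointL : List ℕ → List ℕ → Set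
DisjointL xs ys = ∀ x → x ∈ xs → x ∈ ys → ⊥

EndsOK : BArc → BArc → Set
EndsOK A B = DisjointL (downEnds A) (downEnds B) × DisjointL (upEnds A) (upEnds B)

-- type-B noncrossing arc diagram on n points (a finite set of arcs,
-- given by a list; only its set of members matters)
NCDiagram : ℕ → List BArc → Set
NCDiagram n D =
  All (ValidArc n) D
  × (∀ A B → A ∈ D → B ∈ D → A ≢ B → NonCrossing A B × EndsOK A B)

_≈ₛ_ : List BArc → List BArc → Set
xs ≈ₛ ys = ∀ A → (A ∈ xs → A ∈ ys) × (A ∈ ys → A ∈ xs)

{-# OPTIONS --safe #-}

-- Idea.  Every type-B arc lifts to an arc and its half-turn in the symmetric
-- model.  Call (x , y), x > y, inverted by an arc if the arc starts at or
-- passes right of x and ends at or passes left of y.  For any set of arcs,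
-- pairs inverted by some arc split at every intermediate value, so their
-- transitive closure is the inversion set of a unique permutation; it is
-- centrally symmetric because the set of lifts is.  If the arcs come from a
-- signed permutation π this permutation is π, which gives injectivity.  If
-- they form a noncrossing diagram, two lifts cannot exchange sides, so no
-- value is placed between the ends of an arc and each arc passes every value
-- on the side where the permutation puts it: the arcs are exactly the
-- descents, which gives surjectivity.  Conversely the arcs of δ° π are
-- simultaneously drawn by sliding the points of the graph of π horizontally
-- onto the axis.
module Submission where

open import Defs
open import Data.Bool using (Bool; true; false; not; if_then_else_; T)
open import Data.Nat as ℕ using (ℕ; zero; suc; z≤n; s≤s; _∸_)
import Data.Nat.Properties as ℕ
open import Data.Integer as ℤ using (ℤ; +_; -_; -[1+_]; +[1+_]; ∣_∣; 0ℤ; 1ℤ;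
  _<_; _≤_; _+_; _-_; _<?_; _≟_; +<+; -<-; -<+; +≤+; -≤-; -≤+)
import Data.Integer.Properties as ℤ
open import Data.Integer.Tactic.RingSolver using (solve-∀)
open import Data.Fin using (Fin; toℕ; fromℕ<)
import Data.Fin.Properties as Fin
open import Data.List using (List; []; _∷_; _++_; map; length; reverse; upTo; applyUpTo; _ʳ++_)
import Data.List.Properties as List
open import Data.List.Membership.Propositional using (_∈_; _∉_; find; lose)
open import Data.List.Membership.Propositional.Properties using
  (∈-map⁺; ∈-map⁻; ∈-++⁺ˡ; ∈-++⁺ʳ; ∈-++⁻; ∈-∃++; ∈-upTo⁻; ∈-upTo⁺)
open import Data.List.Relation.Unary.Any as Any using (Any; here; there)
import Data.List.Relation.Unary.Any.Properties as Any
open import Data.List.Relation.Unary.All as All using (All; []; _∷_)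
import Data.List.Relation.Unary.All.Properties as All
open import Data.List.Relation.Unary.AllPairs as AllPairs using (AllPairs; []; _∷_)
import Data.List.Relation.Unary.AllPairs.Properties as AllPairs
open import Data.List.Relation.Unary.Linked as Linked using (Linked; []; [-]; _∷_)
import Data.List.Relation.Unary.Linked.Properties as Linked
open import Data.List.Relation.Unary.Unique.Propositional using (Unique)
import Data.List.Relation.Unary.Unique.Propositional.Properties as Unique
open import Data.List.Relation.Binary.Permutation.Propositional using (_↭_; ↭⇒↭ₛ; ↭-refl; ↭-sym; ↭-trans; prep; swap)
import Data.List.Relation.Binary.Permutation.Propositional.Properties as Perm
open import Relation.Binary.PropositionalEquality using (_≡_; _≢_; refl; sym; trans; cong; cong₂; subst; subst₂;
  setoid; module ≡-Reasoning)
open import Data.List.Relation.Binary.Permutation.Setoid.Properties (setoid ℕ) using (Unique-resp-↭)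
open import Data.Product using (_×_; _,_; ∃; ∃₂; proj₁; proj₂)
open import Data.Sum using (_⊎_; inj₁; inj₂; [_,_]′)
open import Data.Empty using (⊥; ⊥-elim)
open import Data.Unit using (tt)
open import Function using (_∘_; id)
open import Relation.Nullary using (¬_; Dec; yes; no; does)
open import Relation.Nullary.Decidable using (map′; _×-dec_; _⊎-dec_; ¬?; dec-true; dec-false)
open import Relation.Nullary.Negation using (contradiction)
open import Relation.Binary.Definitions using (Tri; tri<; tri≈; tri>)
open import Relation.Binary.Construct.Closure.Transitive using (TransClosure; [_]; _∷_) renaming (_++_ to _⁀_)
open SArc


-- Every pair of arcs of a diagram comes with a drawing of its own, and these need not fit into one
-- picture. Of each drawing essentially one fact is kept: a lift that is left of another at some
-- label is not right of it at a lower label. This exchange property and the rule on shared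
-- endpoints control how chains behave relative to an arc, one step at a time; statements about the
-- bottom of an arc are those about the top of its half-turn.
--
-- In the other direction, positions are odd integers symmetric about 0, so the gap between adjacent
-- positions `m - 1` and `m + 1` has an even midpoint `m`, which names the descent there. The
-- half-turn sends `m` to `- m`, so an arc of the orbifold plane is named by the absolute value of
-- `m`. Drawn at height `h` with abscissa `m` minus the position of `h`, two arcs differ by a
-- constant and cannot cross. The ends then receive the abscissas 1 and -1 instead of 0, which is
-- why these values are collapsed. Height 0 has position 0, so an arc meets the axis at `m`, and the
-- absolute value of `m` is also the radius of the semicircle point.

-- Lifting type-B arcs to the symmetric model

Inside PassesL PassesR On WeakL WeakR : SArc → ℤ → Set
Inside α v = bot α < v × v < top α
PassesL α v = Inside α v × side α v ≡ L
PassesR α v = Inside α v × side α v ≡ R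
On α v = v ≡ top α ⊎ v ≡ bot α
WeakL α v = On α v ⊎ PassesL α v
WeakR α v = On α v ⊎ PassesR α v

-- For an arc of `δ π`, labels passed on the right are listed before its top and labels passed on
-- the left after its bottom, so every pair it inverts is an inversion of `π`.
Inverts : SArc → ℤ → ℤ → Set
Inverts α x y = y < x × (x ≡ top α ⊎ PassesR α x) × (y ≡ bot α ⊎ PassesL α y)

L≢R : ∀ {s} → s ≡ L → s ≡ R → ⊥
L≢R refl ()

-- Side function of an arc through the axis, built from the side lists of its two pieces. The part
-- below the axis is the half-turn of a drawn piece, hence the flip; height `h` has index `h - 1` in
-- a list. The value at 0, which is no label, is arbitrary and does not respect the half-turn, so
-- statements about turned sides carry `v ≢ 0ℤ`.
sides : List Side → List Side → ℤ → Side
sides up down (+ h)    = sideAt up (h ∸ 1)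
sides up down -[1+ h ] = flipSide (sideAt down h)

-- The two arcs (equal for an orbifold arc) of the symmetric model lying over
-- a type-B arc; they are exchanged by the half-turn.
lift : Bool → BArc → SArc
lift _ (orbifold p s) = sarc (+ p) (- + p) (sides s s)
lift false (ordinary p q s) = sarc (+ q) (+ p) λ v → sideAt s (∣ v ∣ ∸ p ∸ 1)
lift true  (ordinary p q s) = sarc (- + p) (- + q) λ v → flipSide (sideAt s (∣ v ∣ ∸ p ∸ 1))
lift false (long l r sl sr) = sarc (+ l) (- + r) (sides sl sr)
lift true  (long l r sl sr) = sarc (+ r) (- + l) (sides sr sl)

flipSide-involutive : ∀ s → flipSide (flipSide s) ≡ s
flipSide-involutive L = refl
flipSide-involutive R = refl

sides-neg : ∀ s t v → v ≢ 0ℤ → sides t s (- v) ≡ flipSide (sides s t v)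
sides-neg s t (+ zero)  v≢0 = contradiction refl v≢0
sides-neg s t +[1+ h ]  _   = refl
sides-neg s t -[1+ h ]  _   = sym (flipSide-involutive (sideAt t h))

-- With `lift-not-bot` and `lift-not-side`, this says that `not` on the index is the half-turn.
-- Arguments by symmetry rest on these three equations instead of on the kind of arc.
lift-not-top : ∀ i A → top (lift (not i) A) ≡ - bot (lift i A)
lift-not-top false (ordinary p q s)  = refl
lift-not-top true  (ordinary p q s)  = sym (ℤ.neg-involutive (+ q))
lift-not-top false (orbifold p s)    = sym (ℤ.neg-involutive (+ p))
lift-not-top true  (orbifold p s)    = sym (ℤ.neg-involutive (+ p))
lift-not-top false (long l r sl sr)  = sym (ℤ.neg-involutive (+ r))
lift-not-top true  (long l r sl sr)  = sym (ℤ.neg-involutive (+ l))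

lift-not-bot : ∀ i A → bot (lift (not i) A) ≡ - top (lift i A)
lift-not-bot false (ordinary p q s)  = refl
lift-not-bot true  (ordinary p q s)  = sym (ℤ.neg-involutive (+ p))
lift-not-bot false (orbifold p s)    = refl
lift-not-bot true  (orbifold p s)    = refl
lift-not-bot false (long l r sl sr)  = refl
lift-not-bot true  (long l r sl sr)  = refl

lift-not-side : ∀ i A v → v ≢ 0ℤ → side (lift (not i) A) (- v) ≡ flipSide (side (lift i A) v)
lift-not-side false (ordinary p q s) v _ =
  cong (λ k → flipSide (sideAt s (k ∸ p ∸ 1))) (ℤ.∣-i∣≡∣i∣ v)
lift-not-side true  (ordinary p q s) v _ =
  trans (cong (λ k → sideAt s (k ∸ p ∸ 1)) (ℤ.∣-i∣≡∣i∣ v)) (sym (flipSide-involutive _))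
lift-not-side false (orbifold p s)   v v≢0 = sides-neg s s v v≢0
lift-not-side true  (orbifold p s)   v v≢0 = sides-neg s s v v≢0
lift-not-side false (long l r sl sr) v v≢0 = sides-neg sl sr v v≢0
lift-not-side true  (long l r sl sr) v v≢0 = sides-neg sr sl v v≢0

Inside-neg : ∀ i A {v} → Inside (lift i A) v → Inside (lift (not i) A) (- v)
Inside-neg i A {v} (b<v , v<t) =
    subst (_< - v) (sym (lift-not-bot i A)) (ℤ.neg-mono-< v<t)
  , subst (- v <_) (sym (lift-not-top i A)) (ℤ.neg-mono-< b<v)

PassesL-neg : ∀ i A {v} → v ≢ 0ℤ → PassesL (lift i A) v → PassesR (lift (not i) A) (- v)
PassesL-neg i A {v} v≢0 (in-v , s≡L) =
  Inside-neg i A in-v , trans (lift-not-side i A v v≢0) (cong flipSide s≡L)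

PassesR-neg : ∀ i A {v} → v ≢ 0ℤ → PassesR (lift i A) v → PassesL (lift (not i) A) (- v)
PassesR-neg i A {v} v≢0 (in-v , s≡R) =
  Inside-neg i A in-v , trans (lift-not-side i A v v≢0) (cong flipSide s≡R)

On-neg : ∀ i A {v} → On (lift i A) v → On (lift (not i) A) (- v)
On-neg i A (inj₁ v≡t) = inj₂ (trans (cong -_ v≡t) (sym (lift-not-bot i A)))
On-neg i A (inj₂ v≡b) = inj₁ (trans (cong -_ v≡b) (sym (lift-not-top i A)))

Inverts-neg : ∀ i A {x y} → x ≢ 0ℤ → y ≢ 0ℤ →
  Inverts (lift i A) x y → Inverts (lift (not i) A) (- y) (- x)
Inverts-neg i A {x} {y} x≢0 y≢0 (y<x , above , below) =
  ℤ.neg-mono-< y<x , new-above below , new-below above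
  where
  new-above : y ≡ bot (lift i A) ⊎ PassesL (lift i A) y →
    - y ≡ top (lift (not i) A) ⊎ PassesR (lift (not i) A) (- y)
  new-above (inj₁ y≡b) = inj₁ (trans (cong -_ y≡b) (sym (lift-not-top i A)))
  new-above (inj₂ l)   = inj₂ (PassesL-neg i A y≢0 l)
  new-below : x ≡ top (lift i A) ⊎ PassesR (lift i A) x →
    - x ≡ bot (lift (not i) A) ⊎ PassesL (lift (not i) A) (- x)
  new-below (inj₁ x≡t) = inj₁ (trans (cong -_ x≡t) (sym (lift-not-bot i A)))
  new-below (inj₂ r)   = inj₂ (PassesR-neg i A x≢0 r)

_≟ˢ_ : (s t : Side) → Dec (s ≡ t)
L ≟ˢ L = yes refl
L ≟ˢ R = no λ ()
R ≟ˢ L = no λ ()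
R ≟ˢ R = yes refl

Inverts? : ∀ α x y → Dec (Inverts α x y)
Inverts? α x y =
  (y <? x) ×-dec (((x ≟ top α) ⊎-dec (Inside? x ×-dec (side α x ≟ˢ R)))
           ×-dec ((y ≟ bot α) ⊎-dec (Inside? y ×-dec (side α y ≟ˢ L))))
  where
  Inside? : ∀ v → Dec (Inside α v)
  Inside? v = (bot α <? v) ×-dec (v <? top α)

-- The order on labels generated by a set of arcs

+-cancelˡ-< : ∀ i j k → i + j < i + k → j < k
+-cancelˡ-< i j k lt = ℤ.≰⇒> λ k≤j → ℤ.<⇒≱ lt (ℤ.+-monoʳ-≤ i k≤j)

neg-≢0 : ∀ {z} → z ≢ 0ℤ → - z ≢ 0ℤ
neg-≢0 z≢0 -z≡0 = z≢0 (ℤ.neg-injective -z≡0)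

-- For the diagram of π the transitive closure of Step is the inversion set
-- of π, and _◁_ is the order in which π lists its entries.
module Inversions (D : List BArc) where

  Lifts : (SArc → Set) → Set
  Lifts P = ∃ λ A → A ∈ D × ∃ λ i → P (lift i A)

  Step : ℤ → ℤ → Set
  Step x y = (x ≢ 0ℤ × y ≢ 0ℤ) × Lifts λ α → Inverts α x y

  Chain : ℤ → ℤ → Set
  Chain = TransClosure Step

  infix 4 _◁_
  _◁_ : ℤ → ℤ → Set
  u ◁ v = (u < v × ¬ Chain v u) ⊎ (v < u × Chain u v)

  Step⇒> : ∀ {x y} → Step x y → y < x
  Step⇒> (_ , _ , _ , _ , y<x , _) = y<x

  Chain⇒> : ∀ {x y} → Chain x y → y < x
  Chain⇒> [ s ]   = Step⇒> s
  Chain⇒> (s ∷ c) = ℤ.<-trans (Chain⇒> c) (Step⇒> s)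

  Step? : ∀ x y → Dec (Step x y)
  Step? x y = (¬? (x ≟ 0ℤ) ×-dec ¬? (y ≟ 0ℤ)) ×-dec map′ to from (Any.any? inv? D)
    where
    P : BArc → Set
    P A = Inverts (lift false A) x y ⊎ Inverts (lift true A) x y
    inv? : ∀ A → Dec (P A)
    inv? A = Inverts? (lift false A) x y ⊎-dec Inverts? (lift true A) x y
    to : Any P D → Lifts λ α → Inverts α x y
    to a with find a
    ... | A , A∈ , inj₁ p = A , A∈ , false , p
    ... | A , A∈ , inj₂ p = A , A∈ , true , p
    from : (Lifts λ α → Inverts α x y) → Any P D
    from (A , A∈ , false , p) = lose A∈ (inj₁ p)
    from (A , A∈ , true , p)  = lose A∈ (inj₂ p)

  -- The arc that makes the step passes `z`. If it passes on the left, `z` can replace the lower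
  -- entry of the pair; if on the right, the upper entry.
  Step-splits : ∀ {x y z} → z ≢ 0ℤ → y < z → z < x → Step x y → Step x z ⊎ Step z y
  Step-splits {x} {y} {z} z≢0 y<z z<x ((x≢0 , y≢0) , A , A∈ , i , _ , above , below) =
    by-side (side α z) refl
    where
    α = lift i A
    x≤top : x ≡ top α ⊎ PassesR α x → x ≤ top α
    x≤top (inj₁ x≡t)             = ℤ.≤-reflexive x≡t
    x≤top (inj₂ ((_ , x<t) , _)) = ℤ.<⇒≤ x<t
    bot≤y : y ≡ bot α ⊎ PassesL α y → bot α ≤ y
    bot≤y (inj₁ y≡b)             = ℤ.≤-reflexive (sym y≡b)
    bot≤y (inj₂ ((b<y , _) , _)) = ℤ.<⇒≤ b<y
    in-z : Inside α z
    in-z = ℤ.≤-<-trans (bot≤y below) y<z , ℤ.<-≤-trans z<x (x≤top above)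
    by-side : ∀ s → side α z ≡ s → Step x z ⊎ Step z y
    by-side L eq = inj₁ ((x≢0 , z≢0) , A , A∈ , i , z<x , above , inj₂ (in-z , eq))
    by-side R eq = inj₂ ((z≢0 , y≢0) , A , A∈ , i , y<z , inj₂ (in-z , eq) , below)

  Chain-splits : ∀ {x y z} → z ≢ 0ℤ → y < z → z < x → Chain x y → Chain x z ⊎ Chain z y
  Chain-splits z≢0 y<z z<x [ s ] with Step-splits z≢0 y<z z<x s
  ... | inj₁ s′ = inj₁ [ s′ ]
  ... | inj₂ s′ = inj₂ [ s′ ]
  Chain-splits {z = z} z≢0 y<z z<x (_∷_ {y = m} s c) with ℤ.<-cmp z m
  ... | tri≈ _ refl _ = inj₂ c
  ... | tri< z<m _ _ with Chain-splits z≢0 y<z z<m c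
  ...   | inj₁ c′ = inj₁ (s ∷ c′)
  ...   | inj₂ c′ = inj₂ c′
  Chain-splits z≢0 y<z z<x (s ∷ c) | tri> _ _ m<z with Step-splits z≢0 m<z z<x s
  ...   | inj₁ s′ = inj₁ [ s′ ]
  ...   | inj₂ s′ = inj₂ (s′ ∷ c)

  Step-neg : ∀ {x y} → Step x y → Step (- y) (- x)
  Step-neg ((x≢0 , y≢0) , A , A∈ , i , inv) =
    (neg-≢0 y≢0 , neg-≢0 x≢0) , A , A∈ , not i , Inverts-neg i A x≢0 y≢0 inv

  Chain-neg : ∀ {x y} → Chain x y → Chain (- y) (- x)
  Chain-neg [ s ]   = [ Step-neg s ]
  Chain-neg (s ∷ c) = Chain-neg c ⁀ [ Step-neg s ]

  Chain-neg⁻ : ∀ {x y} → Chain (- y) (- x) → Chain x y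
  Chain-neg⁻ {x} {y} c =
    subst₂ Chain (ℤ.neg-involutive x) (ℤ.neg-involutive y) (Chain-neg c)

  -- Chains descend strictly, so the second entry of a chain of several steps is one of finitely
  -- many values between `y` and `x`, and the search recurses on a bound for `x - y`. Without
  -- excluded middle, this decision is what makes `_◁_` connex and allows sorting by it.
  Chain? : ∀ x y → Dec (Chain x y)
  Chain? x y = go ∣ x - y ∣ x y (subst (_≤ y + + ∣ x - y ∣) (lem x y)
                 (ℤ.+-monoʳ-≤ y (i≤∣i∣ (x - y))))
    where
    lem : ∀ x y → y + (x - y) ≡ x
    lem = solve-∀
    i≤∣i∣ : ∀ i → i ≤ + ∣ i ∣
    i≤∣i∣ (+ n)    = ℤ.≤-refl
    i≤∣i∣ -[1+ n ] = -≤+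
    lem₁ : ∀ z y → y + (z - y) ≡ z
    lem₁ = solve-∀
    go : ∀ k x y → x ≤ y + + k → Dec (Chain x y)
    go zero x y x≤y =
      no λ c → ℤ.<⇒≱ (Chain⇒> c) (subst (x ≤_) (ℤ.+-identityʳ y) x≤y)
    -- The candidates are `y + 1` up to `y + k`, which exhaust the values strictly between `y` and
    -- `x` and lie within distance `k` of `y`.
    go (suc k) x y x≤y+1+k = map′ to from (Step? x y ⊎-dec Fin.any? λ i →
        Step? x (at (toℕ i)) ×-dec go k (at (toℕ i)) y (ℤ.+-monoʳ-≤ y (+≤+ (Fin.toℕ<n i))))
      where
      at : ℕ → ℤ
      at i = y + +[1+ i ]
      Via : Set
      Via = ∃ λ (i : Fin k) → Step x (at (toℕ i)) × Chain (at (toℕ i)) y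
      to : Step x y ⊎ Via → Chain x y
      to (inj₁ s)           = [ s ]
      to (inj₂ (i , s , c)) = s ∷ c
      via : ∀ z → Step x z → Chain z y → ∀ d → z - y ≡ d → Via
      via z s c (+ zero) eq = contradiction (ℤ.i-j≡0⇒i≡j z y eq) λ { refl → ℤ.<-irrefl refl (Chain⇒> c) }
      via z s c -[1+ d ] eq =
        contradiction (ℤ.i≤j⇒0≤j-i (ℤ.<⇒≤ (Chain⇒> c))) (subst (λ e → ¬ (0ℤ ≤ e)) (sym eq) λ ())
      via z s c +[1+ d ] eq with trans (sym (lem₁ z y)) (cong (λ e → y + e) eq)
      ... | z≡ = fromℕ< d<k , subst (λ e → Step x (at e) × Chain (at e) y) (sym (Fin.toℕ-fromℕ< d<k))
                   (subst (Step x) z≡ s , subst (λ e → Chain e y) z≡ c)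
        where
        d<k : d ℕ.< k
        d<k = ℕ.s<s⁻¹ (ℤ.drop‿+<+ (+-cancelˡ-< y (+ suc d) (+ suc k)
                (ℤ.<-≤-trans (subst (_< x) z≡ (Step⇒> s)) x≤y+1+k)))
      from : Chain x y → Step x y ⊎ Via
      from [ s ]   = inj₁ s
      from (_∷_ {y = z} s c) = inj₂ (via z s c (z - y) refl)

  ◁-asym : ∀ {u v} → u ◁ v → ¬ (v ◁ u)
  ◁-asym (inj₁ (u<v , _))  (inj₁ (v<u , _))  = ℤ.<-asym u<v v<u
  ◁-asym (inj₁ (_ , ¬c))   (inj₂ (_ , c))    = ¬c c
  ◁-asym (inj₂ (_ , c))    (inj₁ (_ , ¬c))   = ¬c c
  ◁-asym (inj₂ (v<u , _))  (inj₂ (u<v , _))  = ℤ.<-asym u<v v<u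

  ◁-connex : ∀ {u v} → u ≢ v → u ◁ v ⊎ v ◁ u
  ◁-connex {u} {v} u≢v with ℤ.<-cmp u v
  ... | tri≈ _ u≡v _ = contradiction u≡v u≢v
  ... | tri< u<v _ _ with Chain? v u
  ...   | yes c = inj₂ (inj₂ (u<v , c))
  ...   | no ¬c = inj₁ (inj₁ (u<v , ¬c))
  ◁-connex {u} {v} u≢v | tri> _ _ v<u with Chain? u v
  ...   | yes c = inj₁ (inj₂ (v<u , c))
  ...   | no ¬c = inj₂ (inj₁ (v<u , ¬c))

  ◁-neg : ∀ {u v} → u ◁ v → (- v) ◁ (- u)
  ◁-neg (inj₁ (u<v , ¬c)) = inj₁ (ℤ.neg-mono-< u<v , λ c → ¬c (Chain-neg⁻ c))
  ◁-neg (inj₂ (v<u , c))  = inj₂ (ℤ.neg-mono-< v<u , Chain-neg c)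

  -- Classical criterion for inversion sets: the set and its complement are both transitive. `Chain`
  -- is transitive by construction, and `Chain-splits` is transitivity of the complement. In the two
  -- mixed cases the outer entries are compared in value, and a chain that passes over one of them
  -- is split there. Splitting is possible at labels only, whence the three inequations.
  ◁-trans : ∀ {u v t} → u ≢ 0ℤ → v ≢ 0ℤ → t ≢ 0ℤ → u ◁ v → v ◁ t → u ◁ t
  ◁-trans _ v≢0 _ (inj₁ (u<v , ¬cvu)) (inj₁ (v<t , ¬ctv)) =
    inj₁ (ℤ.<-trans u<v v<t , λ c → [ ¬ctv , ¬cvu ]′ (Chain-splits v≢0 u<v v<t c))
  ◁-trans _ _ _ (inj₂ (v<u , cuv)) (inj₂ (t<v , cvt)) = inj₂ (ℤ.<-trans t<v v<u , cuv ⁀ cvt)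
  ◁-trans {u} {v} {t} u≢0 _ _ (inj₁ (u<v , ¬cvu)) (inj₂ (t<v , cvt)) with ℤ.<-cmp u t
  ... | tri≈ _ refl _ = contradiction cvt ¬cvu
  ... | tri< u<t _ _ = inj₁ (u<t , λ c → ¬cvu (cvt ⁀ c))
  ... | tri> _ _ t<u = [ (λ c → contradiction c ¬cvu) , (λ c → inj₂ (t<u , c)) ]′ (Chain-splits u≢0 t<u u<v cvt)
  ◁-trans {u} {v} {t} _ _ t≢0 (inj₂ (v<u , cuv)) (inj₁ (v<t , ¬ctv)) with ℤ.<-cmp u t
  ... | tri≈ _ refl _ = contradiction cuv ¬ctv
  ... | tri< u<t _ _ = inj₁ (u<t , λ c → ¬ctv (c ⁀ cuv))
  ... | tri> _ _ t<u = [ (λ c → inj₂ (t<u , c)) , (λ c → contradiction c ¬ctv) ]′ (Chain-splits t≢0 v<t t<u cuv)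

-- Drawn arcs do not exchange sides

-- One arc is weakly left of the label and the other weakly right, at least one of them strictly.
-- This is read off from sides and ends, and it forces a strict inequality of abscissas in every
-- drawing.
LeftAt : SArc → SArc → ℤ → Set
LeftAt α β v = (PassesL α v × WeakR β v) ⊎ (WeakL α v × PassesR β v)

Within : SArc → ℤ → Set
Within α v = bot α ≤ v × v ≤ top α

-- `half i A` draws the part of `lift i A` above the axis; the part below is the half-turn of
-- `half (not i) A`. An arc with a single strand has it for both indices.
half : Bool → BArc → Strand
half _     (ordinary p q s)  = strand q p s numbered
half _     (orbifold p s)    = strand p 0 s axisCenter
half false (long l r sl sr)  = strand l 0 sl axisLeft
half true  (long l r sl sr)  = strand r 0 sr axisRight

Axial : BArc → Set
Axial A = IsAxis (Strand.kind (half false A))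

Axial⇒IsAxis : ∀ i A → Axial A → IsAxis (Strand.kind (half i A))
Axial⇒IsAxis i (orbifold p s) _         = tt
Axial⇒IsAxis false (long l r sl sr) _   = tt
Axial⇒IsAxis true (long l r sl sr) _    = tt

Axial⇒bot≡0 : ∀ i A → Axial A → Strand.bot (half i A) ≡ 0
Axial⇒bot≡0 i (orbifold p s) _          = refl
Axial⇒bot≡0 false (long l r sl sr) _    = refl
Axial⇒bot≡0 true (long l r sl sr) _     = refl

positive≰negative : ∀ {h} k → ¬ (+[1+ h ] ≤ - + k)
positive≰negative zero (+≤+ ())
positive≰negative (suc k) ()

-+≤+ : ∀ k {h} → - + k ≤ + h
-+≤+ zero    = +≤+ z≤n
-+≤+ (suc k) = -≤+

half-within : ∀ i A {h} → Within (lift i A) +[1+ h ] →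
  Strand.bot (half i A) ℕ.≤ suc h × suc h ℕ.≤ Strand.top (half i A)
half-within false (ordinary p q s) (b , t) = ℤ.drop‿+≤+ b , ℤ.drop‿+≤+ t
half-within true (ordinary p q s) (_ , t)  = contradiction t (positive≰negative p)
half-within _ (orbifold p s) (_ , t)       = z≤n , ℤ.drop‿+≤+ t
half-within false (long l r sl sr) (_ , t) = z≤n , ℤ.drop‿+≤+ t
half-within true (long l r sl sr) (_ , t)  = z≤n , ℤ.drop‿+≤+ t

half-inside : ∀ i A {h} → Inside (lift i A) +[1+ h ] →
  Strand.bot (half i A) ℕ.< suc h × suc h ℕ.< Strand.top (half i A)
half-inside false (ordinary p q s) (b , t) = ℤ.drop‿+<+ b , ℤ.drop‿+<+ t
half-inside true (ordinary p q s) (_ , t)  = contradiction (ℤ.<⇒≤ t) (positive≰negative p)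
half-inside _ (orbifold p s) (_ , t)       = s≤s z≤n , ℤ.drop‿+<+ t
half-inside false (long l r sl sr) (_ , t) = s≤s z≤n , ℤ.drop‿+<+ t
half-inside true (long l r sl sr) (_ , t)  = s≤s z≤n , ℤ.drop‿+<+ t

half-side : ∀ i A {h} → Inside (lift i A) +[1+ h ] →
  side (lift i A) +[1+ h ] ≡ sideAt (Strand.sides (half i A)) (suc h ∸ Strand.bot (half i A) ∸ 1)
half-side false (ordinary p q s) _        = refl
half-side true (ordinary p q s) (_ , t)   = contradiction (ℤ.<⇒≤ t) (positive≰negative p)
half-side false (orbifold p s) _          = refl
half-side true (orbifold p s) _           = refl
half-side false (long l r sl sr) _        = refl
half-side true (long l r sl sr) _         = refl

half-on : ∀ i A {h} → On (lift i A) +[1+ h ] →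
  suc h ≡ Strand.top (half i A) ⊎ (suc h ≡ Strand.bot (half i A) × Strand.kind (half i A) ≡ numbered)
half-on false (ordinary p q s) (inj₁ e)  = inj₁ (ℤ.+-injective e)
half-on false (ordinary p q s) (inj₂ e)  = inj₂ (ℤ.+-injective e , refl)
half-on true (ordinary p q s) (inj₁ e)   = contradiction (ℤ.≤-reflexive e) (positive≰negative p)
half-on true (ordinary p q s) (inj₂ e)   = contradiction (ℤ.≤-reflexive e) (positive≰negative q)
half-on _ (orbifold p s) (inj₁ e)        = inj₁ (ℤ.+-injective e)
half-on _ (orbifold p s) (inj₂ e)        = contradiction (ℤ.≤-reflexive e) (positive≰negative p)
half-on false (long l r sl sr) (inj₁ e)  = inj₁ (ℤ.+-injective e)
half-on false (long l r sl sr) (inj₂ e)  = contradiction (ℤ.≤-reflexive e) (positive≰negative r)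
half-on true (long l r sl sr) (inj₁ e)   = inj₁ (ℤ.+-injective e)
half-on true (long l r sl sr) (inj₂ e)   = contradiction (ℤ.≤-reflexive e) (positive≰negative l)

straddling⇒Axial : ∀ i A {x y} → Within (lift i A) +[1+ x ] → Within (lift i A) -[1+ y ] → Axial A
straddling⇒Axial false (ordinary p q s) _ (() , _)
straddling⇒Axial true (ordinary p q s) (_ , t) _ = contradiction t (positive≰negative p)
straddling⇒Axial _ (orbifold p s) _ _        = tt
straddling⇒Axial _ (long l r sl sr) _ _      = tt

Within-neg : ∀ i A {v} → Within (lift i A) v → Within (lift (not i) A) (- v)
Within-neg i A {v} (b≤v , v≤t) =
    subst (_≤ - v) (sym (lift-not-bot i A)) (ℤ.neg-mono-≤ v≤t)
  , subst (- v ≤_) (sym (lift-not-top i A)) (ℤ.neg-mono-≤ b≤v)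

not-interior-zero : ∀ s {x} → SideOK s x → x ≢ 0ℤ
not-interior-zero L x<0 refl = ℤ.<-irrefl refl x<0
not-interior-zero R 0<x refl = ℤ.<-irrefl refl 0<x

-- Two disjoint strands can touch only at a common end, so they keep their
-- order on the way down.
order-kept : ∀ {ρ ρ′ st st′ f g} → Fits ρ (st , f) → Fits ρ′ (st′ , g) →
  Disj (st , f) (st′ , g) → ∀ k {lo} →
  Strand.bot st ℕ.≤ lo → Strand.bot st′ ℕ.≤ lo →
  k ℕ.+ lo ℕ.≤ Strand.top st → k ℕ.+ lo ℕ.≤ Strand.top st′ →
  f lo ≢ g lo → f (k ℕ.+ lo) < g (k ℕ.+ lo) → f lo < g lo
order-kept _ _ _ zero _ _ _ _ _ f<g = f<g
order-kept {st = st} {st′} {f} {g} fit fit′ dis (suc k) {lo} b≤ b′≤ ≤t ≤t′ f≢g f<g =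
  order-kept {st = st} {st′} fit fit′ dis k b≤ b′≤ (ℕ.<⇒≤ ≤t) (ℕ.<⇒≤ ≤t′) f≢g lower
  where
  inRange = dis (k ℕ.+ lo) (ℕ.⊔-lub (ℕ.≤-trans b≤ (ℕ.m≤n+m lo k)) (ℕ.≤-trans b′≤ (ℕ.m≤n+m lo k)))
              (ℕ.⊓-glb (ℕ.<⇒≤ ≤t) (ℕ.<⇒≤ ≤t′))
  apart : ∀ j → j ≡ k → f (j ℕ.+ lo) ≢ g (j ℕ.+ lo)
  apart zero _ = f≢g
  apart (suc j) refl eq = not-interior-zero _
    (proj₁ (proj₂ fit) (suc j ℕ.+ lo) (s≤s (ℕ.≤-trans b≤ (ℕ.m≤n+m lo j))) ≤t)
    (proj₁ inRange (s≤s z≤n) eq)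
  lower : f (k ℕ.+ lo) < g (k ℕ.+ lo)
  lower with ℤ.<-cmp (f (k ℕ.+ lo)) (g (k ℕ.+ lo))
  ... | tri< lt _ _ = lt
  ... | tri≈ _ eq _ = contradiction eq (apart k refl)
  ... | tri> _ _ gt = contradiction f<g (ℤ.<-asym
    (proj₂ (proj₂ inRange (ℕ.⊓-glb ≤t ≤t′) (apart k refl) (ℤ.<⇒≢ f<g)) gt))

Disj-sym : ∀ {x y} → Disj x y → Disj y x
Disj-sym {strand t b _ _ , f} {strand t′ b′ _ _ , g} dis h ≤h h≤
  with dis h (subst (ℕ._≤ h) (ℕ.⊔-comm b′ b) ≤h) (subst (h ℕ.≤_) (ℕ.⊓-comm t′ t) h≤)
... | touch , cross =
    (λ 1≤h eq → trans eq (touch 1≤h (sym eq)))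
  , λ sh≤ ne ne′ → let (p , q) = cross (subst (suc h ℕ.≤_) (ℕ.⊓-comm t′ t) sh≤) (ne ∘ sym) (ne′ ∘ sym) in q , p

-- A drawing unfolded into the plane: `position i` is the abscissa of `lift i A` at a signed height.
-- By `folded` the two halves reach the axis at opposite points, so the half-turn of one continues
-- the other.
record Curves (A : BArc) (D : List DStrand) : Set where
  field
    radius : ℕ
    curve  : Bool → ℕ → ℤ
    drawn  : ∀ i → (half i A , curve i) ∈ D
    fits   : ∀ i → Fits radius (half i A , curve i)
    folded : ∀ i → Axial A → curve (not i) 0 ≡ - curve i 0

  position : Bool → ℤ → ℤ
  position i (+ h)    = curve i h
  position i -[1+ h ] = - curve (not i) (suc h)

  private
    +L : ∀ i {h} → PassesL (lift i A) +[1+ h ] → curve i (suc h) < 0ℤ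
    +L i {h} (ins , s≡L) = subst (λ s → SideOK s (curve i (suc h)))
      (trans (sym (half-side i A ins)) s≡L)
      (proj₁ (proj₂ (fits i)) (suc h) (proj₁ (half-inside i A ins)) (proj₂ (half-inside i A ins)))

    +R : ∀ i {h} → PassesR (lift i A) +[1+ h ] → 0ℤ < curve i (suc h)
    +R i {h} (ins , s≡R) = subst (λ s → SideOK s (curve i (suc h)))
      (trans (sym (half-side i A ins)) s≡R)
      (proj₁ (proj₂ (fits i)) (suc h) (proj₁ (half-inside i A ins)) (proj₂ (half-inside i A ins)))

    +On : ∀ i {h} → On (lift i A) +[1+ h ] → curve i (suc h) ≡ 0ℤ
    +On i on with half-on i A on
    ... | inj₁ e = trans (cong (curve i) e) (proj₁ (fits i))
    ... | inj₂ (e , k≡) = trans (cong (curve i) e)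
      (subst (λ k → BotOK k radius (curve i (Strand.bot (half i A)))) k≡ (proj₂ (proj₂ (fits i))))

  position-L : ∀ i {v} → v ≢ 0ℤ → PassesL (lift i A) v → position i v < 0ℤ
  position-L i {+ zero}   v≢0 _ = contradiction refl v≢0
  position-L i {+[1+ h ]} _   p = +L i p
  position-L i { -[1+ h ]} v≢0 p = ℤ.neg-mono-< (+R (not i) (PassesL-neg i A v≢0 p))

  position-R : ∀ i {v} → v ≢ 0ℤ → PassesR (lift i A) v → 0ℤ < position i v
  position-R i {+ zero}   v≢0 _ = contradiction refl v≢0
  position-R i {+[1+ h ]} _   p = +R i p
  position-R i { -[1+ h ]} v≢0 p = ℤ.neg-mono-< (+L (not i) (PassesR-neg i A v≢0 p))

  position-On : ∀ i {v} → v ≢ 0ℤ → On (lift i A) v → position i v ≡ 0ℤ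
  position-On i {+ zero}   v≢0 _ = contradiction refl v≢0
  position-On i {+[1+ h ]} _   p = +On i p
  position-On i { -[1+ h ]} v≢0 p = cong -_ (+On (not i) (On-neg i A p))

  position-WeakL : ∀ i {v} → v ≢ 0ℤ → WeakL (lift i A) v → position i v ≤ 0ℤ
  position-WeakL i v≢0 = [ ℤ.≤-reflexive ∘ position-On i v≢0 , ℤ.<⇒≤ ∘ position-L i v≢0 ]′

  position-WeakR : ∀ i {v} → v ≢ 0ℤ → WeakR (lift i A) v → 0ℤ ≤ position i v
  position-WeakR i v≢0 = [ ℤ.≤-reflexive ∘ sym ∘ position-On i v≢0 , ℤ.<⇒≤ ∘ position-R i v≢0 ]′

curves : ∀ {A ρ D} → Draw A ρ D → Curves A D
curves {ordinary p q s} {ρ} {(_ , f) ∷ []} (refl , _ , fit ∷ [] , _) = record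
  { radius = ρ ; curve = λ _ → f ; drawn = λ _ → here refl ; fits = λ _ → fit ; folded = λ _ () }
curves {orbifold p s} {ρ} {(_ , f) ∷ []} (refl , _ , fit ∷ [] , _) = record
  { radius = ρ ; curve = λ _ → f ; drawn = λ _ → here refl ; fits = λ _ → fit
  ; folded = λ _ _ → trans (proj₂ (proj₂ fit)) (cong -_ (sym (proj₂ (proj₂ fit)))) }
curves {long l r sl sr} {ρ} {(_ , f) ∷ (_ , g) ∷ []} (refl , _ , fit ∷ fit′ ∷ [] , _) = record
  { radius = ρ
  ; curve  = λ { false → f ; true → g }
  ; drawn  = λ { false → here refl ; true → there (here refl) }
  ; fits   = λ { false → fit ; true → fit′ }
  ; folded = λ { false _ → trans (proj₂ (proj₂ fit′))
                    (trans (sym (ℤ.neg-involutive (+ ρ))) (cong -_ (sym (proj₂ (proj₂ fit)))))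
               ; true _ → trans (proj₂ (proj₂ fit)) (cong -_ (sym (proj₂ (proj₂ fit′)))) } }

LeftAt⇒< : ∀ {A B D E} (a : Curves A D) (b : Curves B E) i j {v} → v ≢ 0ℤ →
  LeftAt (lift i A) (lift j B) v → Curves.position a i v < Curves.position b j v
LeftAt⇒< a b i j v≢0 (inj₁ (l , wr)) =
  ℤ.<-≤-trans (Curves.position-L a i v≢0 l) (Curves.position-WeakR b j v≢0 wr)
LeftAt⇒< a b i j v≢0 (inj₂ (wl , r)) =
  ℤ.≤-<-trans (Curves.position-WeakL a i v≢0 wl) (Curves.position-R b j v≢0 r)

module _ {A B D E} (a : Curves A D) (b : Curves B E) where
  open Curves

  curves-kept : ∀ i j → Disj (half i A , curve a i) (half j B , curve b j) → ∀ {lo hi} → lo ℕ.≤ hi →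
    Strand.bot (half i A) ℕ.≤ lo → Strand.bot (half j B) ℕ.≤ lo →
    hi ℕ.≤ Strand.top (half i A) → hi ℕ.≤ Strand.top (half j B) →
    curve a i lo ≢ curve b j lo → curve a i hi < curve b j hi → curve a i lo < curve b j lo
  curves-kept i j dis {lo} {hi} lo≤hi b≤ b′≤ ≤t ≤t′ ne lt =
    order-kept {st = half i A} {st′ = half j B} (fits a i) (fits b j) dis (hi ∸ lo) b≤ b′≤
      (subst (ℕ._≤ _) (sym hi≡) ≤t) (subst (ℕ._≤ _) (sym hi≡) ≤t′) ne
      (subst (λ k → curve a i k < curve b j k) (sym hi≡) lt)
    where hi≡ = ℕ.m∸n+n≡m lo≤hi

  -- Above the axis the order is kept downward by `curves-kept`; below it, the half-turn reverses
  -- both heights and sides. If the heights straddle the axis, the halves are followed down to the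
  -- axis from `x` and from `- y`, and there the identification of opposite points makes the two
  -- orders contradict each other.
  no-swap : ∀ i j →
    Disj (half i A , curve a i) (half j B , curve b j) →
    Disj (half (not i) A , curve a (not i)) (half (not j) B , curve b (not j)) →
    (Axial A → Axial B → curve a i 0 ≢ curve b j 0) →
    ∀ {x y} → x ≢ 0ℤ → y ≢ 0ℤ → y < x →
    Within (lift i A) x → Within (lift i A) y → Within (lift j B) x → Within (lift j B) y →
    position a i x < position b j x → ¬ (position b j y < position a i y)
  no-swap i j dis dis′ ax {+ zero} x≢0 = contradiction refl x≢0
  no-swap i j dis dis′ ax {_} {+ zero} _ y≢0 = contradiction refl y≢0
  no-swap i j dis dis′ ax {+[1+ x ]} {+[1+ y ]} _ _ (+<+ y<x) Ax Ay Bx By x< y< =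
    ℤ.<-asym y< (curves-kept i j dis (ℕ.<⇒≤ y<x)
      (proj₁ (half-within i A Ay)) (proj₁ (half-within j B By))
      (proj₂ (half-within i A Ax)) (proj₂ (half-within j B Bx)) (ℤ.<⇒≢ y< ∘ sym) x<)
  no-swap i j dis dis′ ax { -[1+ x ]} { -[1+ y ]} _ _ (-<- x<y) Ax Ay Bx By x< y< =
    ℤ.<-asym (ℤ.neg-cancel-< x<) (curves-kept (not i) (not j) dis′ (ℕ.<⇒≤ (s≤s x<y))
      (proj₁ (half-within (not i) A (Within-neg i A Ax))) (proj₁ (half-within (not j) B (Within-neg j B Bx)))
      (proj₂ (half-within (not i) A (Within-neg i A Ay))) (proj₂ (half-within (not j) B (Within-neg j B By)))
      (λ eq → ℤ.<⇒≢ x< (cong -_ eq)) (ℤ.neg-cancel-< y<))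
  no-swap i j dis dis′ ax {+[1+ x ]} { -[1+ y ]} _ _ _ Ax Ay Bx By x< y< =
    ℤ.<-asym (ℤ.neg-cancel-< (subst₂ _<_ (folded a i axA) (folded b j axB) below)) above
    where
    axA = straddling⇒Axial i A Ax Ay
    axB = straddling⇒Axial j B Bx By
    above : curve a i 0 < curve b j 0
    above = curves-kept i j dis z≤n
      (ℕ.≤-reflexive (Axial⇒bot≡0 i A axA)) (ℕ.≤-reflexive (Axial⇒bot≡0 j B axB))
      (proj₂ (half-within i A Ax)) (proj₂ (half-within j B Bx)) (ax axA axB) x<
    below : curve a (not i) 0 < curve b (not j) 0
    below = curves-kept (not i) (not j) dis′ z≤n
      (ℕ.≤-reflexive (Axial⇒bot≡0 (not i) A axA)) (ℕ.≤-reflexive (Axial⇒bot≡0 (not j) B axB))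
      (proj₂ (half-within (not i) A (Within-neg i A Ay))) (proj₂ (half-within (not j) B (Within-neg j B By)))
      (λ eq → ax axA axB (ℤ.neg-injective (trans (sym (folded a i axA)) (trans eq (folded b j axB)))))
      (ℤ.neg-cancel-< y<)

-- Chains and arcs in a noncrossing diagram

_≟ᵇ_ : (A B : BArc) → Dec (A ≡ B)
ordinary p q s ≟ᵇ ordinary p′ q′ s′ =
  map′ (λ { (refl , refl , refl) → refl }) (λ { refl → refl , refl , refl })
    ((p ℕ.≟ p′) ×-dec (q ℕ.≟ q′) ×-dec List.≡-dec _≟ˢ_ s s′)
orbifold p s ≟ᵇ orbifold p′ s′ =
  map′ (λ { (refl , refl) → refl }) (λ { refl → refl , refl }) ((p ℕ.≟ p′) ×-dec List.≡-dec _≟ˢ_ s s′)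
long l r sl sr ≟ᵇ long l′ r′ sl′ sr′ =
  map′ (λ { (refl , refl , refl , refl) → refl }) (λ { refl → refl , refl , refl , refl })
    ((l ℕ.≟ l′) ×-dec (r ℕ.≟ r′) ×-dec List.≡-dec _≟ˢ_ sl sl′ ×-dec List.≡-dec _≟ˢ_ sr sr′)
ordinary _ _ _ ≟ᵇ orbifold _ _  = no λ ()
ordinary _ _ _ ≟ᵇ long _ _ _ _  = no λ ()
orbifold _ _ ≟ᵇ ordinary _ _ _  = no λ ()
orbifold _ _ ≟ᵇ long _ _ _ _    = no λ ()
long _ _ _ _ ≟ᵇ ordinary _ _ _  = no λ ()
long _ _ _ _ ≟ᵇ orbifold _ _    = no λ ()

Proper : SArc → Set
Proper α = top α ≢ 0ℤ × bot α ≢ 0ℤ × bot α < top α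

+≢0 : ∀ {k} → 1 ℕ.≤ k → + k ≢ 0ℤ
+≢0 (s≤s _) ()

-+≢0 : ∀ {k} → 1 ℕ.≤ k → - + k ≢ 0ℤ
-+≢0 (s≤s _) ()

-+<+ : ∀ {k h} → 1 ℕ.≤ k → - + k < + h
-+<+ (s≤s _) = -<+

lift-proper : ∀ {n} i A → ValidArc n A → Proper (lift i A)
lift-proper false (ordinary p q s) (1≤p , p<q , _) =
  +≢0 (ℕ.≤-trans 1≤p (ℕ.<⇒≤ p<q)) , +≢0 1≤p , +<+ p<q
lift-proper true (ordinary p q s) (1≤p , p<q , _) =
  -+≢0 1≤p , -+≢0 (ℕ.≤-trans 1≤p (ℕ.<⇒≤ p<q)) , ℤ.neg-mono-< (+<+ p<q)
lift-proper _ (orbifold p s) (1≤p , _) = +≢0 1≤p , -+≢0 1≤p , -+<+ 1≤p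
lift-proper false (long l r sl sr) (1≤l , _ , 1≤r , _) = +≢0 1≤l , -+≢0 1≤r , -+<+ 1≤r
lift-proper true (long l r sl sr) (1≤l , _ , 1≤r , _) = +≢0 1≤r , -+≢0 1≤l , -+<+ 1≤l

lift-top≤ : ∀ {n} i A → ValidArc n A → ∣ top (lift i A) ∣ ℕ.≤ n
lift-top≤ false (ordinary p q s) (_ , _ , q≤n , _) = q≤n
lift-top≤ true (ordinary p q s) (_ , p<q , q≤n , _) =
  subst (ℕ._≤ _) (sym (ℤ.∣-i∣≡∣i∣ (+ p))) (ℕ.≤-trans (ℕ.<⇒≤ p<q) q≤n)
lift-top≤ _ (orbifold p s) (_ , p≤n , _) = p≤n
lift-top≤ false (long l r sl sr) (_ , l≤n , _) = l≤n
lift-top≤ true (long l r sl sr) (_ , _ , _ , r≤n , _) = r≤n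

lift-bot≤ : ∀ {n} i A → ValidArc n A → ∣ bot (lift i A) ∣ ℕ.≤ n
lift-bot≤ i A valid = subst (ℕ._≤ _)
  (trans (cong ∣_∣ (lift-not-top i A)) (ℤ.∣-i∣≡∣i∣ (bot (lift i A)))) (lift-top≤ (not i) A valid)

top-end : ∀ {n} i A → ValidArc n A →
    (0ℤ < top (lift i A) × ∣ top (lift i A) ∣ ∈ downEnds A)
  ⊎ (top (lift i A) < 0ℤ × ∣ top (lift i A) ∣ ∈ upEnds A)
top-end false (ordinary p q s) (1≤p , p<q , _) = inj₁ (+<+ (ℕ.≤-trans 1≤p (ℕ.<⇒≤ p<q)) , here refl)
top-end true (ordinary p q s) (1≤p , _) = inj₂ (-+<+ 1≤p , here (ℤ.∣-i∣≡∣i∣ (+ p)))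
top-end _ (orbifold p s) (1≤p , _) = inj₁ (+<+ 1≤p , here refl)
top-end false (long l r sl sr) (1≤l , _) = inj₁ (+<+ 1≤l , here refl)
top-end true (long l r sl sr) (_ , _ , 1≤r , _) = inj₁ (+<+ 1≤r , there (here refl))

module _ {l r sl sr ρ E} (dr : Draw (long l r sl sr) ρ E) where
  private
    left  = Curves.curve (curves dr) false
    right = Curves.curve (curves dr) true

  pieces-disjoint : Disj (half false (long l r sl sr) , left) (half true (long l r sl sr) , right)
  pieces-disjoint = go dr
    where
    go : ∀ {E} (dr : Draw (long l r sl sr) ρ E) →
      Disj (half false (long l r sl sr) , Curves.curve (curves dr) false)
           (half true (long l r sl sr) , Curves.curve (curves dr) true)
    go {_ ∷ _ ∷ []} (refl , _ , _ ∷ _ ∷ [] , (dis ∷ []) ∷ _) = dis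

  pieces-disjoint′ : Disj (half true (long l r sl sr) , right) (half false (long l r sl sr) , left)
  pieces-disjoint′ = Disj-sym {half false (long l r sl sr) , left} {half true (long l r sl sr) , right}
                       pieces-disjoint

  pieces-ordered : left 0 < right 0
  pieces-ordered = go dr
    where
    go : ∀ {E} (dr : Draw (long l r sl sr) ρ E) →
      Curves.curve (curves dr) false 0 < Curves.curve (curves dr) true 0
    go {_ ∷ _ ∷ []} (refl , 1≤ρ , (_ , _ , x) ∷ (_ , _ , y) ∷ [] , _) =
      subst₂ _<_ (sym x) (sym y) (-+<+ 1≤ρ)

-- Equality is asserted of the lifts and not of the indices, since an orbifold arc has the same lift
-- under both. The second component lets the half-turn carry a statement about tops over to bottoms.
SameLifts : Bool → BArc → Bool → BArc → Set
SameLifts i A j B = lift i A ≡ lift j B × lift (not i) A ≡ lift (not j) B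

self-top : ∀ {n} i j A → ValidArc n A → top (lift i A) ≡ top (lift j A) → SameLifts i A j A
self-top false false A _ _ = refl , refl
self-top true true A _ _ = refl , refl
self-top false true (ordinary p q s) (s≤s _ , s≤s _ , _) ()
self-top true false (ordinary p q s) (s≤s _ , s≤s _ , _) ()
self-top false true (orbifold p s) _ _ = refl , refl
self-top true false (orbifold p s) _ _ = refl , refl
self-top false true (long l r sl sr) (_ , _ , _ , _ , l≢r , _) e = contradiction (ℤ.+-injective e) l≢r
self-top true false (long l r sl sr) (_ , _ , _ , _ , l≢r , _) e = contradiction (sym (ℤ.+-injective e)) l≢r

LeftAt-irrefl : ∀ α {v} → ¬ LeftAt α α v
LeftAt-irrefl _ (inj₁ ((_ , s≡L) , inj₂ (_ , s≡R))) = L≢R s≡L s≡R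
LeftAt-irrefl _ (inj₂ (inj₂ (_ , s≡L) , (_ , s≡R))) = L≢R s≡L s≡R
LeftAt-irrefl _ (inj₁ (((_ , v<t) , _) , inj₁ (inj₁ refl))) = ℤ.<-irrefl refl v<t
LeftAt-irrefl _ (inj₁ (((b<v , _) , _) , inj₁ (inj₂ refl))) = ℤ.<-irrefl refl b<v
LeftAt-irrefl _ (inj₂ (inj₁ (inj₁ refl) , ((_ , v<t) , _))) = ℤ.<-irrefl refl v<t
LeftAt-irrefl _ (inj₂ (inj₁ (inj₂ refl) , ((b<v , _) , _))) = ℤ.<-irrefl refl b<v

module Noncrossing {n : ℕ} {D : List BArc} (nc : NCDiagram n D) where
  open Inversions D

  valid : ∀ {A} → A ∈ D → ValidArc n A
  valid = All.lookup (proj₁ nc)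

  proper : ∀ {A} → A ∈ D → ∀ i → Proper (lift i A)
  proper {A} A∈ i = lift-proper i A (valid A∈)

  -- Folding keeps a positive top, from which the arc goes downward, and turns a negative top into
  -- an endpoint from which it goes upward. Distinct arcs share neither kind of endpoint; a single
  -- arc is the case of `self-top`, where a long arc relies on its two endpoints being different.
  same-top : ∀ {A B} → A ∈ D → B ∈ D → ∀ i j → top (lift i A) ≡ top (lift j B) → SameLifts i A j B
  same-top {A} {B} A∈ B∈ i j e with A ≟ᵇ B
  ... | yes refl = self-top i j A (valid A∈) e
  ... | no A≢B = contradiction e (clash (top-end i A (valid A∈)) (top-end j B (valid B∈)))
    where
    ends = proj₂ (proj₂ nc A B A∈ B∈ A≢B)
    clash : _ → _ → top (lift i A) ≢ top (lift j B)
    clash (inj₁ (_ , a)) (inj₁ (_ , b)) e = proj₁ ends _ a (subst (λ t → ∣ t ∣ ∈ downEnds B) (sym e) b)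
    clash (inj₂ (_ , a)) (inj₂ (_ , b)) e = proj₂ ends _ a (subst (λ t → ∣ t ∣ ∈ upEnds B) (sym e) b)
    clash (inj₁ (a , _)) (inj₂ (b , _)) e = ℤ.<-asym a (subst (_< 0ℤ) (sym e) b)
    clash (inj₂ (a , _)) (inj₁ (b , _)) e = ℤ.<-asym a (subst (0ℤ <_) (sym e) b)

  same-bot : ∀ {A B} → A ∈ D → B ∈ D → ∀ i j → bot (lift i A) ≡ bot (lift j B) → lift i A ≡ lift j B
  same-bot {A} {B} A∈ B∈ i j e = back i j (same-top A∈ B∈ (not i) (not j)
      (trans (lift-not-top i A) (trans (cong -_ e) (sym (lift-not-top j B)))))
    where
    back : ∀ i j → SameLifts (not i) A (not j) B → lift i A ≡ lift j B
    back false false = proj₂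
    back false true  = proj₂
    back true false  = proj₂
    back true true   = proj₂

  On⇒Within : ∀ α {v} → bot α < top α → On α v → Within α v
  On⇒Within _ b<t (inj₁ refl) = ℤ.<⇒≤ b<t , ℤ.≤-refl
  On⇒Within _ b<t (inj₂ refl) = ℤ.≤-refl , ℤ.<⇒≤ b<t

  LeftAt⇒Within : ∀ α β {v} → bot α < top α → bot β < top β → LeftAt α β v → Within α v × Within β v
  LeftAt⇒Within α β p q (inj₁ (((b , t) , _) , inj₁ on)) = (ℤ.<⇒≤ b , ℤ.<⇒≤ t) , On⇒Within β q on
  LeftAt⇒Within α β p q (inj₁ (((b , t) , _) , inj₂ ((b′ , t′) , _))) = (ℤ.<⇒≤ b , ℤ.<⇒≤ t) , (ℤ.<⇒≤ b′ , ℤ.<⇒≤ t′)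
  LeftAt⇒Within α β p q (inj₂ (inj₁ on , ((b , t) , _))) = On⇒Within α p on , (ℤ.<⇒≤ b , ℤ.<⇒≤ t)
  LeftAt⇒Within α β p q (inj₂ (inj₂ ((b′ , t′) , _) , ((b , t) , _))) = (ℤ.<⇒≤ b′ , ℤ.<⇒≤ t′) , (ℤ.<⇒≤ b , ℤ.<⇒≤ t)

  private
    ordered : ∀ {A B E F} (a : Curves A E) (b : Curves B F) i j →
      bot (lift i A) < top (lift i A) → bot (lift j B) < top (lift j B) →
      Disj (half i A , Curves.curve a i) (half j B , Curves.curve b j) →
      Disj (half (not i) A , Curves.curve a (not i)) (half (not j) B , Curves.curve b (not j)) →
      (Axial A → Axial B → Curves.curve a i 0 ≢ Curves.curve b j 0) →
      ∀ {x y} → x ≢ 0ℤ → y ≢ 0ℤ → y < x →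
      LeftAt (lift i A) (lift j B) x → ¬ LeftAt (lift j B) (lift i A) y
    ordered {A} {B} a b i j pa pb dis dis′ ax x≢0 y≢0 y<x lx ly
      with LeftAt⇒Within (lift i A) (lift j B) pa pb lx | LeftAt⇒Within (lift j B) (lift i A) pb pa ly
    ... | wax , wbx | wby , way =
      no-swap a b i j dis dis′ ax x≢0 y≢0 y<x wax way wbx wby
        (LeftAt⇒< a b i j x≢0 lx) (LeftAt⇒< b a j i y≢0 ly)

  -- `NonCrossing` only concerns different arcs. The two lifts of one arc coincide for an orbifold
  -- arc, have no height in common for an ordinary arc, and for a long arc are kept apart by the
  -- drawing of disjoint pieces that validity provides.
  self-noncrossing : ∀ A → ValidArc n A → ∀ i j {x y} → x ≢ 0ℤ → y ≢ 0ℤ → y < x →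
    LeftAt (lift i A) (lift j A) x → ¬ LeftAt (lift j A) (lift i A) y
  self-noncrossing A v false false _ _ _ lx _ = LeftAt-irrefl (lift false A) lx
  self-noncrossing A v true true _ _ _ lx _   = LeftAt-irrefl (lift true A) lx
  self-noncrossing (orbifold p s) v false true _ _ _ lx _ =
    LeftAt-irrefl (lift false (orbifold p s)) lx
  self-noncrossing (orbifold p s) v true false _ _ _ lx _ =
    LeftAt-irrefl (lift true (orbifold p s)) lx
  self-noncrossing A@(ordinary p q s) v@(s≤s _ , _) false true _ _ _ lx _
    with LeftAt⇒Within (lift false A) (lift true A) (proj₂ (proj₂ (lift-proper false A v)))
           (proj₂ (proj₂ (lift-proper true A v))) lx
  ... | (b≤x , _) , (_ , x≤t) = contradiction (ℤ.≤-trans b≤x x≤t) λ ()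
  self-noncrossing A@(ordinary p q s) v@(s≤s _ , _) true false _ _ _ lx _
    with LeftAt⇒Within (lift true A) (lift false A) (proj₂ (proj₂ (lift-proper true A v)))
           (proj₂ (proj₂ (lift-proper false A v))) lx
  ... | (_ , x≤t) , (b≤x , _) = contradiction (ℤ.≤-trans b≤x x≤t) λ ()
  self-noncrossing (long l r sl sr) v@(_ , _ , _ , _ , _ , _ , _ , _ , _ , dr) false true =
    ordered (curves dr) (curves dr) false true
      (proj₂ (proj₂ (lift-proper false (long l r sl sr) v))) (proj₂ (proj₂ (lift-proper true (long l r sl sr) v)))
      (pieces-disjoint dr) (pieces-disjoint′ dr) (λ _ _ → ℤ.<⇒≢ (pieces-ordered dr))
  self-noncrossing (long l r sl sr) v@(_ , _ , _ , _ , _ , _ , _ , _ , _ , dr) true false =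
    ordered (curves dr) (curves dr) true false
      (proj₂ (proj₂ (lift-proper true (long l r sl sr) v))) (proj₂ (proj₂ (lift-proper false (long l r sl sr) v)))
      (pieces-disjoint′ dr) (pieces-disjoint dr) (λ _ _ → ℤ.<⇒≢ (pieces-ordered dr) ∘ sym)

  noncrossing : ∀ {A B} → A ∈ D → B ∈ D → ∀ i j {x y} → x ≢ 0ℤ → y ≢ 0ℤ → y < x →
    LeftAt (lift i A) (lift j B) x → ¬ LeftAt (lift j B) (lift i A) y
  noncrossing {A} {B} A∈ B∈ i j with A ≟ᵇ B
  ... | yes refl = self-noncrossing A (valid A∈) i j
  ... | no A≢B with proj₁ (proj₂ nc A B A∈ B∈ A≢B)
  ...   | _ , DA , _ , DB , drA , drB , apart =
    ordered a b i j (proj₂ (proj₂ (proper A∈ i))) (proj₂ (proj₂ (proper B∈ j)))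
      (proj₁ (both i j)) (proj₁ (both (not i) (not j)))
      (λ axA axB eq → proj₂ (both i j) (Axial⇒IsAxis i A axA) (Axial⇒IsAxis j B axB) (cong ∣_∣ eq))
    where
    a = curves drA
    b = curves drB
    both : ∀ i j → Disj (half i A , Curves.curve a i) (half j B , Curves.curve b j)
                 × AxisOK (half i A , Curves.curve a i) (half j B , Curves.curve b j)
    both i j = All.lookup (All.lookup apart (Curves.drawn a i)) (Curves.drawn b j)

  private
    WithinR : ∀ α {v} → v ≡ top α ⊎ PassesR α v → WeakR α v
    WithinR α = [ inj₁ ∘ inj₁ , inj₂ ]′

    WithinL : ∀ α {v} → v ≡ bot α ⊎ PassesL α v → WeakL α v
    WithinL α = [ inj₁ ∘ inj₂ , inj₂ ]′

    passes≤ : ∀ α {v} → v ≡ top α ⊎ PassesR α v → v ≤ top α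
    passes≤ α (inj₁ e)             = ℤ.≤-reflexive e
    passes≤ α (inj₂ ((_ , t) , _)) = ℤ.<⇒≤ t

    passes≥ : ∀ α {v} → v ≡ bot α ⊎ PassesL α v → bot α ≤ v
    passes≥ α (inj₁ e)             = ℤ.≤-reflexive (sym e)
    passes≥ α (inj₂ ((b , _) , _)) = ℤ.<⇒≤ b

  module _ {A} (A∈ : A ∈ D) (i : Bool) where
    private
      α = lift i A
      a = top α
      b = bot α

    -- Were `y` passed on the right, the arc making the step would be right of `α` at `x` and left
    -- of it at `y`. At `x` this can fail to be strict only if both arcs start there, and then they
    -- are the same lift.
    step-stays-right : ∀ {x y} → x ≡ a ⊎ PassesL α x → b < y → Step x y → PassesL α y
    step-stays-right {x} {y} at-x b<y ((x≢0 , y≢0) , B , B∈ , j , y<x , above , below) =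
      by-side (side α y) refl
      where
      β = lift j B
      x≤a : x ≡ a ⊎ PassesL α x → x ≤ a
      x≤a (inj₁ e)             = ℤ.≤-reflexive e
      x≤a (inj₂ ((_ , t) , _)) = ℤ.<⇒≤ t
      in-y : Inside α y
      in-y = b<y , ℤ.<-≤-trans y<x (x≤a at-x)
      crossed : PassesR α y → LeftAt α β x → ⊥
      crossed r lx = noncrossing A∈ B∈ i j x≢0 y≢0 y<x lx (inj₂ (WithinL β below , r))
      not-right : PassesR α y → x ≡ a ⊎ PassesL α x → x ≡ top β ⊎ PassesR β x → ⊥
      not-right r (inj₂ l) ab          = crossed r (inj₁ (l , WithinR β ab))
      not-right r (inj₁ e) (inj₂ r′)   = crossed r (inj₂ (inj₁ (inj₁ e) , r′))
      not-right r (inj₁ e) (inj₁ e′)   = same below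
        where
        α≡β : α ≡ β
        α≡β = proj₁ (same-top A∈ B∈ i j (trans (sym e) e′))
        same : y ≡ bot β ⊎ PassesL β y → ⊥
        same (inj₁ y≡b) = ℤ.<⇒≢ b<y (sym (trans y≡b (cong bot (sym α≡β))))
        same (inj₂ (_ , s≡L)) = L≢R (trans (cong (λ γ → side γ y) α≡β) s≡L) (proj₂ r)
      by-side : ∀ s → side α y ≡ s → PassesL α y
      by-side L eq = in-y , eq
      by-side R eq = ⊥-elim (not-right (in-y , eq) at-x above)

    chain-stays-right : ∀ {x y} → x ≡ a ⊎ PassesL α x → b < y → Chain x y → PassesL α y
    chain-stays-right at-x b<y [ s ]   = step-stays-right at-x b<y s
    chain-stays-right at-x b<y (s ∷ c) =
      chain-stays-right (inj₂ (step-stays-right at-x (ℤ.<-trans b<y (Chain⇒> c)) s)) b<y c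

    -- If the arc making the step passes left of `b`, it exchanges sides with `α` between `x` and
    -- `b`. If it ends at `b`, it is the same lift as `α`, which passes left of `x` and so does not
    -- invert this pair.
    no-step-to-bot : ∀ {x} → PassesL α x → ¬ Step x b
    no-step-to-bot {x} l@((_ , x<a) , s≡L) ((x≢0 , b≢0) , B , B∈ , j , b<x , above , below) = go below
      where
      β = lift j B
      go : b ≡ bot β ⊎ PassesL β b → ⊥
      go (inj₂ l′) = noncrossing A∈ B∈ i j x≢0 b≢0 b<x (inj₁ (l , WithinR β above)) (inj₁ (l′ , inj₁ (inj₂ refl)))
      go (inj₁ e) = same above
        where
        α≡β : α ≡ β
        α≡β = same-bot A∈ B∈ i j e
        same : x ≡ top β ⊎ PassesR β x → ⊥
        same (inj₁ e′) = ℤ.<⇒≢ x<a (trans e′ (cong top (sym α≡β)))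
        same (inj₂ (_ , s≡R)) = L≢R s≡L (trans (cong (λ γ → side γ x) α≡β) s≡R)

    no-chain-to-bot : ∀ {x} → PassesL α x → ¬ Chain x b
    no-chain-to-bot l [ s ]   = no-step-to-bot l s
    no-chain-to-bot l (s ∷ c) = no-chain-to-bot (step-stays-right (inj₂ l) (Chain⇒> c) s) c

    -- Otherwise the arc making the step would pass right of the top of α and
    -- exchange sides with α further down.
    step-stops-at-top : ∀ {v z} → a < v → z < a → z ≡ b ⊎ PassesR α z → Step v z → Step v a
    step-stops-at-top {v} {z} a<v z<a at-z ((v≢0 , z≢0) , B , B∈ , j , z<v , above , below) =
      by-side (side β a) refl
      where
      β = lift j B
      a≢0 = proj₁ (proper A∈ i)
      in-a : Inside β a
      in-a = ℤ.≤-<-trans (passes≥ β below) z<a , ℤ.<-≤-trans a<v (passes≤ β above)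
      crossed : PassesR β a → LeftAt β α z → ⊥
      crossed r = noncrossing A∈ B∈ i j a≢0 z≢0 z<a (inj₂ (inj₁ (inj₁ refl) , r))
      not-right : PassesR β a → z ≡ b ⊎ PassesR α z → z ≡ bot β ⊎ PassesL β z → ⊥
      not-right r (inj₂ r′) be        = crossed r (inj₂ (WithinL β be , r′))
      not-right r (inj₁ e) (inj₂ l)   = crossed r (inj₁ (l , inj₁ (inj₂ e)))
      not-right r (inj₁ e) (inj₁ e′)  = ℤ.<⇒≢ (proj₂ in-a)
        (cong top (same-bot A∈ B∈ i j (trans (sym e) e′)))
      by-side : ∀ s → side β a ≡ s → Step v a
      by-side L eq = (v≢0 , a≢0) , B , B∈ , j , a<v , above , inj₂ (in-a , eq)
      by-side R eq = ⊥-elim (not-right (in-a , eq) at-z below)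

    chain-stops-at-top : ∀ {v} → a < v → Chain v b → Chain v a
    chain-stops-at-top a<v [ s ] = [ step-stops-at-top a<v (proj₂ (proj₂ (proper A∈ i))) (inj₁ refl) s ]
    chain-stops-at-top a<v (_∷_ {y = z} s c) with ℤ.<-cmp z a
    ... | tri≈ _ refl _ = [ s ]
    ... | tri> _ _ a<z = s ∷ chain-stops-at-top a<z c
    -- This step jumps over the top. Since a chain leads on from `z` to the bottom, `α` cannot pass
    -- left of `z`.
    ... | tri< z<a _ _ = [ step-stops-at-top a<v z<a (inj₂ (right (side α z) refl)) s ]
      where
      right : ∀ t → side α z ≡ t → PassesR α z
      right R eq = (Chain⇒> c , z<a) , eq
      right L eq = contradiction c (no-chain-to-bot ((Chain⇒> c , z<a) , eq))

  module _ {A} (A∈ : A ∈ D) (i : Bool) where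
    private
      α = lift i A
      a = top α
      b = bot α
      a≢0 = proj₁ (proper A∈ i)
      b≢0 = proj₁ (proj₂ (proper A∈ i))
      b<a = proj₂ (proj₂ (proper A∈ i))

    chain-starts-at-bot : ∀ {v} → v < b → Chain a v → Chain b v
    chain-starts-at-bot {v} v<b c = Chain-neg⁻ (subst (Chain (- v)) (lift-not-top i A)
      (chain-stops-at-top A∈ (not i) (subst (_< - v) (sym (lift-not-top i A)) (ℤ.neg-mono-< v<b))
        (subst (Chain (- v)) (sym (lift-not-bot i A)) (Chain-neg c))))

    top◁bot : a ◁ b
    top◁bot = inj₂ (b<a , [ (a≢0 , b≢0) , A , A∈ , i , b<a , inj₁ refl , inj₁ refl ])

    right⇒◁top : ∀ {v} → PassesR α v → v ◁ a
    right⇒◁top ((b<v , v<a) , s≡R) =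
      inj₁ (v<a , λ c → L≢R (proj₂ (chain-stays-right A∈ i (inj₁ refl) b<v c)) s≡R)

    -- This is `chain-stays-right` for the half-turned lift, whose top is the negated bottom of `α`.
    left⇒bot◁ : ∀ {v} → v ≢ 0ℤ → PassesL α v → b ◁ v
    left⇒bot◁ {v} v≢0 l@((b<v , v<a) , _) = inj₁ (b<v , λ c →
      L≢R (proj₂ (chain-stays-right A∈ (not i) (inj₁ (sym (lift-not-top i A)))
        (subst (_< - v) (sym (lift-not-bot i A)) (ℤ.neg-mono-< v<a)) (Chain-neg c)))
      (proj₂ (PassesL-neg i A v≢0 l)))

    -- The cases are the possible places of `v` in value. Above the top, a chain from `v` to the
    -- bottom would already give one to the top; below the bottom, a chain from the top to `v` would
    -- already give one from the bottom; strictly inside, a chain from the top makes the arc pass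
    -- left of `v`, after which no chain leads to the bottom.
    nothing-between : ∀ {v} → v ≢ 0ℤ → a ◁ v → ¬ (v ◁ b)
    nothing-between {v} v≢0 (inj₁ (a<v , ¬c)) (inj₁ (v<b , _)) = ℤ.<-asym b<a (ℤ.<-trans a<v v<b)
    nothing-between {v} v≢0 (inj₁ (a<v , ¬c)) (inj₂ (b<v , c)) = ¬c (chain-stops-at-top A∈ i a<v c)
    nothing-between {v} v≢0 (inj₂ (v<a , c)) (inj₁ (v<b , ¬c)) = ¬c (chain-starts-at-bot v<b c)
    nothing-between {v} v≢0 (inj₂ (v<a , c)) (inj₂ (b<v , c′)) =
      no-chain-to-bot A∈ i (chain-stays-right A∈ i (inj₁ refl) b<v c) c′

-- Ordered lists and the descents of a word

module _ {a} {A : Set a} where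

  AllPairs-before : ∀ {R : A → A → Set} {x v} (p : List A) {q} →
    AllPairs R (p ++ x ∷ q) → v ∈ p → R v x
  AllPairs-before (_ ∷ p) (rs ∷ _)  (here refl) = All.lookup rs (∈-++⁺ʳ p (here refl))
  AllPairs-before (_ ∷ p) (_ ∷ rss) (there v∈)  = AllPairs-before p rss v∈

  AllPairs-after : ∀ {R : A → A → Set} {x v} (p : List A) {q} →
    AllPairs R (p ++ x ∷ q) → v ∈ q → R x v
  AllPairs-after []      (rs ∷ _)  v∈ = All.lookup rs v∈
  AllPairs-after (_ ∷ p) (_ ∷ rss) v∈ = AllPairs-after p rss v∈

  AllPairs-connex : ∀ {R : A → A → Set} {xs x y} → AllPairs R xs → x ∈ xs → y ∈ xs →
    x ≢ y → R x y ⊎ R y x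
  AllPairs-connex _         (here refl) (here refl) x≢y = contradiction refl x≢y
  AllPairs-connex (rs ∷ _)  (here refl) (there y∈)  _   = inj₁ (All.lookup rs y∈)
  AllPairs-connex (rs ∷ _)  (there x∈)  (here refl) _   = inj₂ (All.lookup rs x∈)
  AllPairs-connex (_ ∷ rss) (there x∈)  (there y∈)  x≢y = AllPairs-connex rss x∈ y∈ x≢y

  Linked-adjacent : ∀ {R : A → A → Set} {x y} (p : List A) {q} → Linked R (p ++ x ∷ y ∷ q) → R x y
  Linked-adjacent []          (r ∷ _)  = r
  Linked-adjacent (_ ∷ [])    (_ ∷ rs) = Linked-adjacent [] rs
  Linked-adjacent (_ ∷ z ∷ p) (_ ∷ rs) = Linked-adjacent (z ∷ p) rs

  ∈-split : ∀ (p : List A) {x y q v} → v ∈ p ++ x ∷ y ∷ q → v ≢ x → v ≢ y → v ∈ p ⊎ v ∈ q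
  ∈-split p v∈ v≢x v≢y with ∈-++⁻ p v∈
  ... | inj₁ v∈p                = inj₁ v∈p
  ... | inj₂ (here v≡x)         = contradiction v≡x v≢x
  ... | inj₂ (there (here v≡y)) = contradiction v≡y v≢y
  ... | inj₂ (there (there v∈q)) = inj₂ v∈q

  -- Pigeonhole: each entry of `xs` uses up one occurrence in `ys`, so none is left over.
  Unique-exhausts : ∀ {xs ys : List A} {y} → Unique xs → (∀ {z} → z ∈ xs → z ∈ ys) →
    length ys ℕ.≤ length xs → y ∈ ys → y ∈ xs
  Unique-exhausts {[]} {_ ∷ _} _ _ () _
  Unique-exhausts {x ∷ xs} (x∉ ∷ u) sub len y∈ with ∈-∃++ (sub (here refl))
  ... | ps , qs , refl = [ rest ∘ ∈-++⁺ˡ , (λ { (here y≡x) → here y≡x ; (there y∈qs) → rest (∈-++⁺ʳ ps y∈qs) }) ]′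
                           (∈-++⁻ ps y∈)
    where
    sub′ : ∀ {z} → z ∈ xs → z ∈ ps ++ qs
    sub′ z∈ with ∈-++⁻ ps (sub (there z∈))
    ... | inj₁ z∈ps          = ∈-++⁺ˡ z∈ps
    ... | inj₂ (here refl)   = contradiction refl (All.lookup x∉ z∈)
    ... | inj₂ (there z∈qs)  = ∈-++⁺ʳ ps z∈qs
    len′ : length (ps ++ qs) ℕ.≤ length xs
    len′ = ℕ.s≤s⁻¹ (subst (ℕ._≤ _) (Perm.↭-length (Perm.shift x ps qs)) len)
    rest : ∀ {y} → y ∈ ps ++ qs → y ∈ x ∷ xs
    rest y∈ = there (Unique-exhausts u sub′ len′ y∈)

memℤ-∈ : ∀ {v xs} → v ∈ xs → memℤ v xs ≡ true
memℤ-∈ {v} (here refl) rewrite dec-true (v ≟ v) refl = refl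
memℤ-∈ {v} {x ∷ xs} (there v∈) with does (v ≟ x)
... | true  = refl
... | false = memℤ-∈ v∈

memℤ-∉ : ∀ {v xs} → v ∉ xs → memℤ v xs ≡ false
memℤ-∉ {v} {[]} _ = refl
memℤ-∉ {v} {x ∷ xs} v∉ rewrite dec-false (v ≟ x) (v∉ ∘ here) = memℤ-∉ (v∉ ∘ there)

descentArc : ℤ → ℤ → List ℤ → SArc
descentArc x y pre = sarc x y λ v → if memℤ v pre then R else L

descents⁻ : ∀ pre w {α} → α ∈ descents pre w →
  ∃₂ λ p x → ∃₂ λ y q → w ≡ p ++ x ∷ y ∷ q × y < x × α ≡ descentArc x y (pre ++ p)
descents⁻ pre (x ∷ y ∷ w) {α} α∈ =
  [ first , later ∘ descents⁻ (pre ++ x ∷ []) (y ∷ w) ]′ (∈-++⁻ (if does (y <? x) then _ else []) α∈)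
  where
  Split : List ℤ → List ℤ → Set
  Split pre w = ∃₂ λ p x → ∃₂ λ y q → w ≡ p ++ x ∷ y ∷ q × y < x × α ≡ descentArc x y (pre ++ p)
  first : α ∈ (if does (y <? x) then descentArc x y pre ∷ [] else []) → Split pre (x ∷ y ∷ w)
  first α∈ with y <? x
  first (here e) | yes y<x =
    [] , x , y , w , refl , y<x , trans e (cong (descentArc x y) (sym (List.++-identityʳ pre)))
  later : Split (pre ++ x ∷ []) (y ∷ w) → Split pre (x ∷ y ∷ w)
  later (p , x′ , y′ , q , e , lt , e′) =
    x ∷ p , x′ , y′ , q , cong (x ∷_) e , lt , trans e′ (cong (descentArc x′ y′) (List.++-assoc pre (x ∷ []) p))

descents-skip : ∀ pre z z′ w {α} →
  α ∈ descents (pre ++ z ∷ []) (z′ ∷ w) → α ∈ descents pre (z ∷ z′ ∷ w)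
descents-skip pre z z′ w = ∈-++⁺ʳ
  (if does (z′ <? z) then sarc z z′ (λ v → if memℤ v pre then R else L) ∷ [] else [])

descents⁺ : ∀ pre p q {x y} → y < x → descentArc x y (pre ++ p) ∈ descents pre (p ++ x ∷ y ∷ q)
descents⁺ pre [] q {x} {y} y<x rewrite dec-true (y <? x) y<x =
  here (cong (descentArc x y) (List.++-identityʳ pre))
descents⁺ pre (z ∷ []) q {x} {y} y<x =
  descents-skip pre z x (y ∷ q) (subst (λ l → descentArc x y l ∈ descents (pre ++ z ∷ []) (x ∷ y ∷ q))
    (List.++-identityʳ (pre ++ z ∷ [])) (descents⁺ (pre ++ z ∷ []) [] q y<x))
descents⁺ pre (z ∷ z′ ∷ p) q {x} {y} y<x =
  descents-skip pre z z′ (p ++ x ∷ y ∷ q)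
    (subst (λ l → descentArc x y l ∈ descents (pre ++ z ∷ []) (z′ ∷ p ++ x ∷ y ∷ q))
      (List.++-assoc pre (z ∷ []) (z′ ∷ p)) (descents⁺ (pre ++ z ∷ []) (z′ ∷ p) q y<x))

-- Positions in the long one-line notation

-- Centred positions: the entries of longWord π sit at the odd numbers
-- 1 - 2n, …, -1, 1, …, 2n - 1, and the half-turn negates the position.
posFrom : ℤ → List ℤ → ℤ → ℤ
posFrom k []       z = 0ℤ
posFrom k (x ∷ xs) z =
  if does (z ≟ x) then k else if does (z ≟ - x) then - k else posFrom (k + + 2) xs z

i≡-i⇒i≡0 : ∀ {i} → i ≡ - i → i ≡ 0ℤ
i≡-i⇒i≡0 {+ zero} _ = refl
i≡-i⇒i≡0 {+[1+ n ]} ()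
i≡-i⇒i≡0 { -[1+ n ]} ()

∣i∣≡∣j∣⇒ : ∀ i j → ∣ i ∣ ≡ ∣ j ∣ → i ≡ j ⊎ i ≡ - j
∣i∣≡∣j∣⇒ i j e with ℤ.+∣i∣≡i⊎+∣i∣≡-i i | ℤ.+∣i∣≡i⊎+∣i∣≡-i j
... | inj₁ p | inj₁ q = inj₁ (trans (sym p) (trans (cong +_ e) q))
... | inj₁ p | inj₂ q = inj₂ (trans (sym p) (trans (cong +_ e) q))
... | inj₂ p | inj₁ q = inj₂ (trans (sym (ℤ.neg-involutive i)) (cong -_ (trans (sym p) (trans (cong +_ e) q))))
... | inj₂ p | inj₂ q = inj₁ (ℤ.neg-injective (trans (sym p) (trans (cong +_ e) q)))

-- A `z` that does not occur up to sign is covered by the default 0; at `z = 0ℤ` this puts the axis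
-- at the centre, on which the drawings rely. An entry 0 would equal its own negative, while `k`
-- need not.
posFrom-neg : ∀ k {xs} → All (_≢ 0ℤ) xs → ∀ z → posFrom k xs (- z) ≡ - posFrom k xs z
posFrom-neg k [] z = refl
posFrom-neg k {x ∷ xs} (x≢0 ∷ xs≢0) z with - z ≟ x | - z ≟ - x | z ≟ x | z ≟ - x
... | yes -z≡x | _ | yes refl | _ = contradiction (i≡-i⇒i≡0 (sym -z≡x)) x≢0
... | yes _    | _ | no _ | yes _ = sym (ℤ.neg-involutive k)
... | yes refl | _ | no _ | no z≢ = contradiction (sym (ℤ.neg-involutive z)) z≢
... | no _ | yes _  | yes _ | _ = refl
... | no _ | yes e | no z≢ | _ = contradiction (ℤ.neg-injective e) z≢
... | no _ | no e | yes refl | _ = contradiction refl e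
... | no e | no _ | no _ | yes refl = contradiction (ℤ.neg-involutive x) e
... | no _ | no _ | no _ | no _ = posFrom-neg (k + + 2) xs≢0 z

odds : ℤ → ℕ → List ℤ
odds k zero    = []
odds k (suc m) = k ∷ odds (k + + 2) m

map-posFrom : ∀ k {xs} → Unique (map ∣_∣ xs) → map (posFrom k xs) xs ≡ odds k (length xs)
map-posFrom k {[]} _ = refl
map-posFrom k {x ∷ xs} (x∉ ∷ u) = cong₂ _∷_ head-pos (trans (List.map-cong-local tail-pos) (map-posFrom (k + + 2) u))
  where
  head-pos : posFrom k (x ∷ xs) x ≡ k
  head-pos rewrite dec-true (x ≟ x) refl = refl
  skip : ∀ {z} → ∣ x ∣ ≢ ∣ z ∣ → posFrom k (x ∷ xs) z ≡ posFrom (k + + 2) xs z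
  skip {z} ne rewrite dec-false (z ≟ x) (λ e → ne (cong ∣_∣ (sym e)))
                    | dec-false (z ≟ - x) (λ e → ne (trans (sym (ℤ.∣-i∣≡∣i∣ x)) (cong ∣_∣ (sym e)))) = refl
  tail-pos : All (λ z → posFrom k (x ∷ xs) z ≡ posFrom (k + + 2) xs z) xs
  tail-pos = All.map skip (All.map⁻ x∉)

TwoApart : ℤ → ℤ → Set
TwoApart i j = j ≡ i + + 2

odds-linked : ∀ k m → Linked TwoApart (odds k m)
odds-linked k zero          = []
odds-linked k (suc zero)    = [-]
odds-linked k (suc (suc m)) = refl ∷ odds-linked (k + + 2) (suc m)

-- The reversed append grows to the left of `y`; the invariant is that the next mirrored value `- k`
-- lies two below `y`. It starts with -1 and 1, where the two halves meet.
mirrored-linked : ∀ k m {y ys} → TwoApart (- k) y → Linked TwoApart (y ∷ ys) →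
  Linked TwoApart (map -_ (odds k m) ʳ++ (y ∷ ys))
mirrored-linked k zero    _ link = link
mirrored-linked k (suc m) e link = mirrored-linked (k + + 2) m (lem k) (e ∷ link)
  where
  lem : ∀ k → - k ≡ - (k + + 2) + + 2
  lem = solve-∀

module Word {n : ℕ} {π : List ℤ} (sp : IsSignedPerm n π) where

  pos : ℤ → ℤ
  pos = posFrom 1ℤ π

  word : List ℤ
  word = longWord π

  private
    nonzero : All (_≢ 0ℤ) π
    nonzero = All.map proj₁ (proj₁ (proj₂ sp))

  pos-neg : ∀ z → pos (- z) ≡ - pos z
  pos-neg = posFrom-neg 1ℤ nonzero

  word-linked : Linked (λ x y → TwoApart (pos x) (pos y)) word
  word-linked = Linked.map⁻ (subst (Linked TwoApart) (sym positions) (linked (length π)))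
    where
    linked : ∀ m → Linked TwoApart (map -_ (odds 1ℤ m) ʳ++ odds 1ℤ m)
    linked zero    = []
    linked (suc m) = mirrored-linked 1ℤ (suc m) refl (odds-linked 1ℤ (suc m))
    open ≡-Reasoning
    positions : map pos word ≡ map -_ (odds 1ℤ (length π)) ʳ++ odds 1ℤ (length π)
    positions = begin
      map pos (reverse (map -_ π) ++ π)             ≡⟨ List.map-++ pos (reverse (map -_ π)) π ⟩
      map pos (reverse (map -_ π)) ++ map pos π     ≡⟨ cong (_++ map pos π) (List.reverse-map pos (map -_ π)) ⟩
      reverse (map pos (map -_ π)) ++ map pos π     ≡⟨ cong (λ l → reverse l ++ map pos π) (sym (List.map-∘ π)) ⟩
      reverse (map (pos ∘ -_) π) ++ map pos π       ≡⟨ cong (λ l → reverse l ++ map pos π) (List.map-cong pos-neg π) ⟩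
      reverse (map (-_ ∘ pos) π) ++ map pos π       ≡⟨ cong (λ l → reverse l ++ map pos π) (List.map-∘ π) ⟩
      reverse (map -_ (map pos π)) ++ map pos π     ≡⟨ sym (List.ʳ++-defn (map -_ (map pos π))) ⟩
      map -_ (map pos π) ʳ++ map pos π              ≡⟨ cong (λ l → map -_ l ʳ++ l) (map-posFrom 1ℤ (proj₂ (proj₂ sp))) ⟩
      map -_ (odds 1ℤ (length π)) ʳ++ odds 1ℤ (length π) ∎

  -- Positions of distinct entries are at least two apart, so an entry that is not next to a
  -- midpoint is more than 1 away from it, beyond the reach of `collapse`.
  Gap : ℤ → ℤ → Set
  Gap x y = pos x + + 2 ≤ pos y

  word-gaps : AllPairs Gap word
  word-gaps = Linked.Linked⇒AllPairs
    (λ {x} {y} {z} p q → ℤ.≤-trans p (ℤ.≤-trans (ℤ.i≤i+j (pos y) (+ 2)) q))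
    (Linked.map (ℤ.≤-reflexive ∘ sym) word-linked)

  Gap⇒< : ∀ {x y} → Gap x y → pos x < pos y
  Gap⇒< {x} g = ℤ.<-≤-trans (subst (_< pos x + + 2) (ℤ.+-identityʳ (pos x)) (ℤ.+-monoʳ-< (pos x) (+<+ (s≤s z≤n)))) g

  <⇒Gap : ∀ {x y} → x ∈ word → y ∈ word → pos x < pos y → Gap x y
  <⇒Gap {x} {y} x∈ y∈ lt with AllPairs-connex word-gaps x∈ y∈ (λ { refl → ℤ.<-irrefl refl lt })
  ... | inj₁ g = g
  ... | inj₂ g = contradiction lt (ℤ.<-asym (Gap⇒< {y} {x} g))

  pos-injective : ∀ {x y} → x ∈ word → y ∈ word → pos x ≡ pos y → x ≡ y
  pos-injective {x} {y} x∈ y∈ e with x ≟ y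
  ... | yes x≡y = x≡y
  ... | no x≢y with AllPairs-connex word-gaps x∈ y∈ x≢y
  ...   | inj₁ g = contradiction e (ℤ.<⇒≢ (Gap⇒< {x} {y} g))
  ...   | inj₂ g = contradiction (sym e) (ℤ.<⇒≢ (Gap⇒< {y} {x} g))

  ∈-word⁻ : ∀ {z} → z ∈ word → z ≢ 0ℤ × ∣ z ∣ ℕ.≤ n
  ∈-word⁻ {z} z∈ with ∈-++⁻ (reverse (map -_ π)) z∈
  ... | inj₂ z∈π = All.lookup (proj₁ (proj₂ sp)) z∈π
  ... | inj₁ z∈r with ∈-map⁻ -_ (Any.reverse⁻ z∈r)
  ...   | v , v∈π , refl with All.lookup (proj₁ (proj₂ sp)) v∈π
  ...     | v≢0 , v≤n = neg-≢0 v≢0 , subst (ℕ._≤ n) (sym (ℤ.∣-i∣≡∣i∣ v)) v≤n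

  ∈-word⁺ : ∀ {z} → z ≢ 0ℤ → ∣ z ∣ ℕ.≤ n → z ∈ word
  ∈-word⁺ {z} z≢0 ∣z∣≤n = place (∈-map⁻ ∣_∣ (Unique-exhausts (proj₂ (proj₂ sp)) sub len (num z z≢0 ∣z∣≤n)))
    where
    labels : List ℕ
    labels = map suc (upTo n)
    num : ∀ v → v ≢ 0ℤ → ∣ v ∣ ℕ.≤ n → ∣ v ∣ ∈ labels
    num (+ zero) v≢0 _   = contradiction refl v≢0
    num +[1+ k ] _   k<n = ∈-map⁺ suc (∈-upTo⁺ k<n)
    num -[1+ k ] _   k<n = ∈-map⁺ suc (∈-upTo⁺ k<n)
    sub : ∀ {k} → k ∈ map ∣_∣ π → k ∈ labels
    sub k∈ with ∈-map⁻ ∣_∣ k∈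
    ... | v , v∈ , refl with All.lookup (proj₁ (proj₂ sp)) v∈
    ...   | v≢0 , v≤n = num v v≢0 v≤n
    len : length labels ℕ.≤ length (map ∣_∣ π)
    len = ℕ.≤-reflexive (trans (trans (List.length-map suc (upTo n)) (List.length-upTo n))
            (sym (trans (List.length-map ∣_∣ π) (proj₁ sp))))
    place : (∃ λ v → v ∈ π × ∣ z ∣ ≡ ∣ v ∣) → z ∈ word
    place (v , v∈ , e) with ∣i∣≡∣j∣⇒ z v e
    ... | inj₁ refl = ∈-++⁺ʳ (reverse (map -_ π)) v∈
    ... | inj₂ refl = ∈-++⁺ˡ (Any.reverse⁺ (∈-map⁺ -_ v∈))

  ∈-word-neg : ∀ {z} → z ∈ word → - z ∈ word
  ∈-word-neg {z} z∈ with ∈-word⁻ z∈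
  ... | z≢0 , ∣z∣≤n = ∈-word⁺ (neg-≢0 z≢0) (subst (ℕ._≤ n) (sym (ℤ.∣-i∣≡∣i∣ z)) ∣z∣≤n)

  pos≢0 : ∀ {z} → z ∈ word → pos z ≢ 0ℤ
  pos≢0 {z} z∈ e = proj₁ (∈-word⁻ z∈) (i≡-i⇒i≡0 (pos-injective z∈ (∈-word-neg z∈)
    (trans e (sym (trans (pos-neg z) (cong -_ e))))))

-- Side lists as functions of the height

[1+p+i]∸p∸1≡i : ∀ p i → suc (p ℕ.+ i) ∸ p ∸ 1 ≡ i
[1+p+i]∸p∸1≡i p i = cong (_∸ 1) (trans (cong (_∸ p) (sym (ℕ.+-suc p i))) (ℕ.m+n∸m≡n p (suc i)))

∈-between⁻ : ∀ {p q h} → h ∈ between p q → p ℕ.< h × h ℕ.< q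
∈-between⁻ {p} {q} h∈ with ∈-map⁻ (λ i → suc (p ℕ.+ i)) h∈
... | i , i∈ , refl = s≤s (ℕ.m≤m+n p i) , ℕ.≰⇒> λ q≤ → ℕ.<⇒≱ (∈-upTo⁻ i∈)
  (subst (q ∸ p ∸ 1 ℕ.≤_) ([1+p+i]∸p∸1≡i p i) (ℕ.∸-monoˡ-≤ 1 (ℕ.∸-monoˡ-≤ p q≤)))

sideAt-applyUpTo : ∀ f {k i} → i ℕ.< k → sideAt (applyUpTo f k) i ≡ f i
sideAt-applyUpTo f {suc k} {zero}  _         = refl
sideAt-applyUpTo f {suc k} {suc i} (s≤s i<k) = sideAt-applyUpTo (f ∘ suc) i<k

applyUpTo-sideAt : ∀ s → applyUpTo (sideAt s) (length s) ≡ s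
applyUpTo-sideAt []      = refl
applyUpTo-sideAt (x ∷ s) = cong (x ∷_) (applyUpTo-sideAt s)

map-between : ∀ (g : ℕ → Side) p q → map g (between p q) ≡ applyUpTo (λ i → g (suc (p ℕ.+ i))) (q ∸ p ∸ 1)
map-between g p q = trans (sym (List.map-∘ (upTo (q ∸ p ∸ 1)))) (List.map-upTo (λ i → g (suc (p ℕ.+ i))) (q ∸ p ∸ 1))

sideAt-between : ∀ g {p q h} → p ℕ.< h → h ℕ.< q → sideAt (map g (between p q)) (h ∸ p ∸ 1) ≡ g h
sideAt-between g {p} {q} {h} p<h h<q with ℕ.m≤n⇒∃[o]m+o≡n p<h
... | i , refl = begin
  sideAt (map g (between p q)) (h ∸ p ∸ 1)  ≡⟨ cong₂ sideAt (map-between g p q) ([1+p+i]∸p∸1≡i p i) ⟩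
  sideAt (applyUpTo (λ j → g (suc (p ℕ.+ j))) (q ∸ p ∸ 1)) i
    ≡⟨ sideAt-applyUpTo (λ j → g (suc (p ℕ.+ j))) i< ⟩
  g h                                       ∎
  where
  open ≡-Reasoning
  i< : i ℕ.< q ∸ p ∸ 1
  i< = subst (ℕ._< q ∸ p ∸ 1) ([1+p+i]∸p∸1≡i p i)
    (ℕ.∸-monoˡ-< (ℕ.∸-monoˡ-< h<q (ℕ.<⇒≤ p<h)) (ℕ.m<n⇒0<n∸m p<h))

between-sideAt : ∀ {p q} s → length s ≡ q ∸ p ∸ 1 → map (λ h → sideAt s (h ∸ p ∸ 1)) (between p q) ≡ s
between-sideAt {p} {q} s len = begin
  map (λ h → sideAt s (h ∸ p ∸ 1)) (between p q)
    ≡⟨ map-between (λ h → sideAt s (h ∸ p ∸ 1)) p q ⟩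
  applyUpTo (λ i → sideAt s (suc (p ℕ.+ i) ∸ p ∸ 1)) (q ∸ p ∸ 1)
    ≡⟨ sym (List.map-upTo (λ i → sideAt s (suc (p ℕ.+ i) ∸ p ∸ 1)) (q ∸ p ∸ 1)) ⟩
  map (λ i → sideAt s (suc (p ℕ.+ i) ∸ p ∸ 1)) (upTo (q ∸ p ∸ 1))
    ≡⟨ List.map-cong (λ i → cong (sideAt s) ([1+p+i]∸p∸1≡i p i)) (upTo (q ∸ p ∸ 1)) ⟩
  map (sideAt s) (upTo (q ∸ p ∸ 1))
    ≡⟨ List.map-upTo (sideAt s) (q ∸ p ∸ 1) ⟩
  applyUpTo (sideAt s) (q ∸ p ∸ 1)
    ≡⟨ cong (applyUpTo (sideAt s)) (sym len) ⟩
  applyUpTo (sideAt s) (length s)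
    ≡⟨ applyUpTo-sideAt s ⟩
  s ∎
  where open ≡-Reasoning

length-between : ∀ (g : ℕ → Side) p q → length (map g (between p q)) ≡ q ∸ p ∸ 1
length-between g p q = trans (cong length (map-between g p q))
  (List.length-applyUpTo (λ i → g (suc (p ℕ.+ i))) (q ∸ p ∸ 1))

-- Drawing all arcs of a signed permutation at once

-- Collapses -1, 0 and 1; it is what brings the ends of a drawn strand onto
-- the vertical axis without disturbing the order of the strands.
collapse : ℤ → ℤ
collapse (+ zero)          = 0ℤ
collapse (+ suc zero)      = 0ℤ
collapse (+ suc (suc k))   = + suc (suc k)
collapse -[1+ zero ]       = 0ℤ
collapse -[1+ suc k ]      = -[1+ suc k ]

collapse-mono : ∀ {i j} → i ≤ j → collapse i ≤ collapse j
collapse-mono (-≤+ {m} {k}) = ℤ.≤-trans (neg m) (nonneg k)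
  where
  nonneg : ∀ k → 0ℤ ≤ collapse (+ k)
  nonneg zero          = ℤ.≤-refl
  nonneg (suc zero)    = ℤ.≤-refl
  nonneg (suc (suc k)) = +≤+ z≤n
  neg : ∀ k → collapse -[1+ k ] ≤ 0ℤ
  neg zero    = ℤ.≤-refl
  neg (suc k) = -≤+
collapse-mono (+≤+ {zero} {zero} _)              = ℤ.≤-refl
collapse-mono (+≤+ {zero} {suc zero} _)          = ℤ.≤-refl
collapse-mono (+≤+ {zero} {suc (suc _)} _)       = +≤+ z≤n
collapse-mono (+≤+ {suc zero} {suc zero} _)      = ℤ.≤-refl
collapse-mono (+≤+ {suc zero} {suc (suc _)} _)   = +≤+ z≤n
collapse-mono (+≤+ {suc (suc _)} {suc zero} (s≤s ()))
collapse-mono (+≤+ {suc (suc _)} {suc (suc _)} p) = +≤+ p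
collapse-mono (-≤- {zero} {zero} _)              = ℤ.≤-refl
collapse-mono (-≤- {suc _} {zero} _)             = -≤+
collapse-mono (-≤- {suc _} {suc _} p)            = -≤- p

collapse-id : ∀ {i} → i ≢ 1ℤ → - i ≢ 1ℤ → collapse i ≡ i
collapse-id {+ zero} _ _           = refl
collapse-id {+ suc zero} i≢1 _     = contradiction refl i≢1
collapse-id {+ suc (suc k)} _ _    = refl
collapse-id { -[1+ zero ]} _ -i≢1  = contradiction refl -i≢1
collapse-id { -[1+ suc k ]} _ _    = refl

-- Only -1, 0 and 1 are merged, and their common value is the abscissa of the numbered points, where
-- `Disj` lets strands meet.
collapse-touch : ∀ {i j} → collapse i ≡ collapse j → i ≡ j ⊎ collapse i ≡ 0ℤ
collapse-touch {+ zero} _ = inj₂ refl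
collapse-touch {+ suc zero} _ = inj₂ refl
collapse-touch { -[1+ zero ]} _ = inj₂ refl
collapse-touch {+ suc (suc k)} {+ suc (suc l)} e = inj₁ e
collapse-touch { -[1+ suc k ]} { -[1+ suc l ]} e = inj₁ e
collapse-touch {+ suc (suc k)} {+ zero} ()
collapse-touch {+ suc (suc k)} {+ suc zero} ()
collapse-touch {+ suc (suc k)} { -[1+ zero ]} ()
collapse-touch {+ suc (suc k)} { -[1+ suc _ ]} ()
collapse-touch { -[1+ suc k ]} {+ zero} ()
collapse-touch { -[1+ suc k ]} {+ suc zero} ()
collapse-touch { -[1+ suc k ]} {+ suc (suc _)} ()
collapse-touch { -[1+ suc k ]} { -[1+ zero ]} ()

collapse-pos : ∀ {i} → 1ℤ < i → 0ℤ < collapse i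
collapse-pos {+ suc zero} (+<+ (s≤s ()))
collapse-pos {+ suc (suc k)} _ = +<+ (s≤s z≤n)

collapse-neg : ∀ {i} → i < - 1ℤ → collapse i < 0ℤ
collapse-neg { -[1+ zero ]} (-<- ())
collapse-neg { -[1+ suc k ]} _ = -<+

-- The arcs of δ π are drawn through the graph of pos: an arc between the
-- positions m - 1 and m + 1 runs at height h at distance m - pos h from the axis.
module Drawing {n : ℕ} {π : List ℤ} (sp : IsSignedPerm n π) where
  open Word sp public

  sideOf : ℤ → ℕ → Side
  sideOf m h = if does (pos (+ h) <? m) then R else L

  track : ℤ → ℕ → ℤ
  track m h = collapse (m - pos (+ h))

  Clear : ℤ → ℕ → ℕ → Set
  Clear m b t = ∀ h → b ℕ.< h → h ℕ.< t → pos (+ h) + 1ℤ < m ⊎ m + 1ℤ < pos (+ h)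

  seg : ℤ → ℕ → ℕ → List Side
  seg m b t = map (sideOf m) (between b t)

  i<i+1 : ∀ i → i < i + 1ℤ
  i<i+1 i = subst (_< i + 1ℤ) (ℤ.+-identityʳ i) (ℤ.+-monoʳ-< i (+<+ (s≤s z≤n)))

  sideOf-R : ∀ {m h} → pos (+ h) + 1ℤ < m → sideOf m h ≡ R
  sideOf-R {m} {h} lt rewrite dec-true (pos (+ h) <? m) (ℤ.<-trans (i<i+1 _) lt) = refl

  sideOf-L : ∀ {m h} → m + 1ℤ < pos (+ h) → sideOf m h ≡ L
  sideOf-L {m} {h} lt rewrite dec-false (pos (+ h) <? m) (ℤ.<-asym (ℤ.<-trans (i<i+1 m) lt)) = refl

  pos-0 : pos 0ℤ ≡ 0ℤ
  pos-0 = i≡-i⇒i≡0 (pos-neg 0ℤ)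

  -- Before `collapse`, the two tracks differ by the constant `m - m′` at every height, so neither
  -- overtakes the other; being monotone, `collapse` can only make them touch, and that only at 0.
  tracks-disjoint : ∀ {m m′ st st′} → m ≢ m′ → Disj (st , track m) (st′ , track m′)
  tracks-disjoint {m} {m′} m≢m′ h _ _ =
    (λ _ e → [ (λ e′ → contradiction (lem e′) m≢m′) , id ]′ (collapse-touch e))
    , λ _ _ ne → (λ lt → kept m m′ lt ne) , (λ lt → kept m′ m lt (ne ∘ sym))
    where
    lem : m - pos (+ h) ≡ m′ - pos (+ h) → m ≡ m′
    lem e = trans (restore m (pos (+ h))) (trans (cong (_+ pos (+ h)) e) (sym (restore m′ (pos (+ h)))))
      where
      restore : ∀ i j → i ≡ i - j + j
      restore = solve-∀
    kept : ∀ k l → track k h < track l h → track k (suc h) ≢ track l (suc h) → track k (suc h) < track l (suc h)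
    kept k l lt ne = ℤ.≤∧≢⇒< (collapse-mono (ℤ.+-monoˡ-≤ (- pos (+ suc h)) (ℤ.<⇒≤ k<l))) ne
      where
      k<l : k < l
      k<l = ℤ.≰⇒> λ l≤k → ℤ.<⇒≱ lt (collapse-mono (ℤ.+-monoˡ-≤ (- pos (+ h)) l≤k))

  -- A descent with midpoint `m` has its top at position `m - 1` and its bottom at `m + 1`. Opposite
  -- descents have midpoints `m` and `- m`, and one of them is singled out: for an ordinary arc that
  -- of the lift above the axis, for a long arc the negative one, because the piece with midpoint
  -- `m` reaches the axis at abscissa `m` and has to be the left piece there.
  data Shape : BArc → ℤ → Set where
    ord : ∀ {p q m} → 1 ℕ.≤ p → p ℕ.< q → q ℕ.≤ n →
      pos (+ q) + 1ℤ ≡ m → pos (+ p) ≡ m + 1ℤ → Clear m p q →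
      Shape (ordinary p q (seg m p q)) m
    orb : ∀ {p} → 1 ℕ.≤ p → p ℕ.≤ n → pos (+ p) + 1ℤ ≡ 0ℤ → Clear 0ℤ 0 p →
      Shape (orbifold p (seg 0ℤ 0 p)) 0ℤ
    lng : ∀ {l r m} → 1 ℕ.≤ l → l ℕ.≤ n → 1 ℕ.≤ r → r ℕ.≤ n →
      pos (+ l) + 1ℤ ≡ m → pos (+ r) + 1ℤ ≡ - m → m < 0ℤ → Clear m 0 l → Clear (- m) 0 r →
      Shape (long l r (seg m 0 l) (seg (- m) 0 r)) m

  numbered∈ : ∀ {k} → 1 ℕ.≤ k → k ℕ.≤ n → + k ∈ word
  numbered∈ 1≤k k≤n = ∈-word⁺ (+≢0 1≤k) k≤n

  pos-numbered-injective : ∀ {j k} → 1 ℕ.≤ j → j ℕ.≤ n → 1 ℕ.≤ k → k ℕ.≤ n → pos (+ j) ≡ pos (+ k) → j ≡ k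
  pos-numbered-injective a b c d e = ℤ.+-injective (pos-injective (numbered∈ a b) (numbered∈ c d) e)

  +1-cancel : ∀ {i j} → i + 1ℤ ≡ j + 1ℤ → i ≡ j
  +1-cancel {i} {j} e = trans (lem i) (trans (cong (_+ - 1ℤ) e) (sym (lem j)))
    where
    lem : ∀ i → i ≡ i + 1ℤ + - 1ℤ
    lem = solve-∀

  private
    -- j and -k would share a position
    clash : ∀ {j k m} → 1 ℕ.≤ j → j ℕ.≤ n → 1 ℕ.≤ k → k ℕ.≤ n →
      pos (+ j) ≡ m + 1ℤ → pos (+ k) + 1ℤ ≡ - m → ⊥
    clash {j} {k} {m} 1≤j j≤n 1≤k k≤n ej ek = contradiction
      (pos-injective (numbered∈ 1≤j j≤n) (∈-word-neg (numbered∈ 1≤k k≤n))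
        (trans ej (trans (lem ek) (sym (pos-neg (+ k))))))
      (ℤ.<⇒≢ (-+<+ 1≤k) ∘ sym)
      where
      l₁ : ∀ i → - (i + 1ℤ) + 1ℤ ≡ - i
      l₁ = solve-∀
      lem : pos (+ k) + 1ℤ ≡ - m → m + 1ℤ ≡ - pos (+ k)
      lem e = trans (cong (_+ 1ℤ) (trans (sym (ℤ.neg-involutive m)) (cong -_ (sym e)))) (l₁ (pos (+ k)))

  -- The midpoint gives the positions of both ends, and distinct labels have distinct positions. For
  -- opposite nonzero midpoints, either a positive label would share its position with a negative
  -- one, or two long arcs would both have negative midpoints; neither is possible.
  Shape-unique : ∀ {A B m m′} → Shape A m → Shape B m′ → ∣ m ∣ ≡ ∣ m′ ∣ → A ≡ B
  Shape-unique {m = m} {m′} s t e = [ (λ { refl → same s t }) , (λ { refl → opposite s t refl }) ]′ (∣i∣≡∣j∣⇒ m m′ e)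
    where
    same : ∀ {A B m} → Shape A m → Shape B m → A ≡ B
    same (ord 1≤p p<q q≤n eq ep _) (ord 1≤p′ p<q′ q≤n′ eq′ ep′ _)
      with pos-numbered-injective (ℕ.≤-trans 1≤p (ℕ.<⇒≤ p<q)) q≤n (ℕ.≤-trans 1≤p′ (ℕ.<⇒≤ p<q′)) q≤n′
             (+1-cancel (trans eq (sym eq′)))
         | pos-numbered-injective 1≤p (ℕ.≤-trans (ℕ.<⇒≤ p<q) q≤n) 1≤p′ (ℕ.≤-trans (ℕ.<⇒≤ p<q′) q≤n′)
             (trans ep (sym ep′))
    ... | refl | refl = refl
    same (ord 1≤p p<q q≤n _ ep _) (orb 1≤p′ p≤n′ e _) =
      ⊥-elim (clash {m = 0ℤ} 1≤p (ℕ.≤-trans (ℕ.<⇒≤ p<q) q≤n) 1≤p′ p≤n′ ep e)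
    same (orb 1≤p′ p≤n′ e _) (ord 1≤p p<q q≤n _ ep _) =
      ⊥-elim (clash {m = 0ℤ} 1≤p (ℕ.≤-trans (ℕ.<⇒≤ p<q) q≤n) 1≤p′ p≤n′ ep e)
    same (ord 1≤p p<q q≤n _ ep _) (lng _ _ 1≤r r≤n _ er _ _ _) =
      ⊥-elim (clash 1≤p (ℕ.≤-trans (ℕ.<⇒≤ p<q) q≤n) 1≤r r≤n ep er)
    same (lng _ _ 1≤r r≤n _ er _ _ _) (ord 1≤p p<q q≤n _ ep _) =
      ⊥-elim (clash 1≤p (ℕ.≤-trans (ℕ.<⇒≤ p<q) q≤n) 1≤r r≤n ep er)
    same (orb 1≤p p≤n e _) (orb 1≤p′ p≤n′ e′ _)
      with pos-numbered-injective 1≤p p≤n 1≤p′ p≤n′ (+1-cancel (trans e (sym e′)))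
    ... | refl = refl
    same (orb _ _ _ _) (lng _ _ _ _ _ _ m<0 _ _) = contradiction m<0 (ℤ.<-irrefl refl)
    same (lng _ _ _ _ _ _ m<0 _ _) (orb _ _ _ _) = contradiction m<0 (ℤ.<-irrefl refl)
    same (lng 1≤l l≤n 1≤r r≤n el er _ _ _) (lng 1≤l′ l≤n′ 1≤r′ r≤n′ el′ er′ _ _ _)
      with pos-numbered-injective 1≤l l≤n 1≤l′ l≤n′ (+1-cancel (trans el (sym el′)))
         | pos-numbered-injective 1≤r r≤n 1≤r′ r≤n′ (+1-cancel (trans er (sym er′)))
    ... | refl | refl = refl
    opposite : ∀ {A B m m′} → Shape A m → Shape B m′ → m ≡ - m′ → A ≡ B
    opposite (ord 1≤p p<q q≤n eq _ _) (ord 1≤p′ p<q′ q≤n′ _ ep′ _) e =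
      ⊥-elim (clash 1≤p′ (ℕ.≤-trans (ℕ.<⇒≤ p<q′) q≤n′) (ℕ.≤-trans 1≤p (ℕ.<⇒≤ p<q)) q≤n ep′ (trans eq e))
    opposite s@(ord _ _ _ _ _ _) t@(orb _ _ _ _) refl = same s t
    opposite {m′ = m′} s@(orb _ _ _ _) t e with ℤ.neg-injective {0ℤ} {m′} e
    ... | refl = same s t
    opposite {m′ = m′} (ord 1≤p p<q q≤n _ ep _) (lng 1≤l l≤n _ _ el _ _ _ _) e =
      ⊥-elim (clash 1≤p (ℕ.≤-trans (ℕ.<⇒≤ p<q) q≤n) 1≤l l≤n ep
        (trans el (trans (sym (ℤ.neg-involutive m′)) (cong -_ (sym e)))))
    opposite (lng 1≤l l≤n _ _ el _ _ _ _) (ord 1≤p p<q q≤n _ ep _) e =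
      ⊥-elim (clash 1≤p (ℕ.≤-trans (ℕ.<⇒≤ p<q) q≤n) 1≤l l≤n ep (trans el e))
    opposite s@(lng _ _ _ _ _ _ _ _ _) t@(orb _ _ _ _) refl = same s t
    opposite (lng _ _ _ _ _ _ m<0 _ _) (lng _ _ _ _ _ _ m′<0 _ _) refl =
      contradiction m<0 (ℤ.<-asym (ℤ.neg-mono-< m′<0))

  -- At its top a track has abscissa `collapse 1ℤ`, that is 0; strictly inside, `Clear` keeps the
  -- abscissa out of the collapsed range, hence on its own side.
  strand-fits : ∀ ρ k {m t b} → pos (+ t) + 1ℤ ≡ m → Clear m b t → BotOK k ρ (track m b) →
    Fits ρ (strand t b (seg m b t) k , track m)
  strand-fits ρ k {m} {t} {b} refl clear bottom = cong collapse (lem (pos (+ t))) , sided , bottom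
    where
    lem : ∀ i → i + 1ℤ - i ≡ 1ℤ
    lem = solve-∀
    sided : ∀ h → b ℕ.< h → h ℕ.< t → SideOK (sideAt (seg m b t) (h ∸ b ∸ 1)) (track m h)
    sided h b<h h<t = subst (λ s → SideOK s (track m h)) (sym (sideAt-between (sideOf m) b<h h<t))
      (go (clear h b<h h<t))
      where
      go : pos (+ h) + 1ℤ < m ⊎ m + 1ℤ < pos (+ h) → SideOK (sideOf m h) (track m h)
      go (inj₁ lt) = subst (λ s → SideOK s (track m h)) (sym (sideOf-R {m} {h} lt)) (collapse-pos
        (subst (_< m - pos (+ h)) (lem (pos (+ h))) (ℤ.+-monoˡ-< (- pos (+ h)) lt)))
      go (inj₂ lt) = subst (λ s → SideOK s (track m h)) (sym (sideOf-L {m} {h} lt)) (collapse-neg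
        (subst₂ _<_ (lem₁ m (pos (+ h))) (lem₂ (pos (+ h))) (ℤ.+-monoˡ-< (- 1ℤ - pos (+ h)) lt)))
        where
        lem₁ : ∀ i j → i + 1ℤ + (- 1ℤ - j) ≡ i - j
        lem₁ = solve-∀
        lem₂ : ∀ i → i + (- 1ℤ - i) ≡ - 1ℤ
        lem₂ = solve-∀

  drawing : ∀ {A m} → Shape A m → List DStrand
  drawing {A} {m} (ord _ _ _ _ _ _) = map (_, track m) (strands A)
  drawing {A} {m} (orb _ _ _ _)     = map (_, track m) (strands A)
  drawing (lng {l} {r} {m} _ _ _ _ _ _ _ _ _) =
    (strand l 0 (seg m 0 l) axisLeft , track m) ∷ (strand r 0 (seg (- m) 0 r) axisRight , track (- m)) ∷ []

  track-numbered-bot : ∀ {m p} → pos (+ p) ≡ m + 1ℤ → track m p ≡ 0ℤ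
  track-numbered-bot {m} e = cong collapse (trans (cong (λ i → m - i) e) (lem m))
    where
    lem : ∀ i → i - (i + 1ℤ) ≡ - 1ℤ
    lem = solve-∀

  track-0 : ∀ {m} → m ≢ 1ℤ → - m ≢ 1ℤ → track m 0 ≡ m
  track-0 {m} m≢1 -m≢1 = trans
    (cong collapse (trans (cong (λ i → m - i) pos-0) (ℤ.+-identityʳ m))) (collapse-id m≢1 -m≢1)

  -- A midpoint 1 would put `k` at the centre. It has to be excluded because `collapse` would move
  -- the point on the axis from `m` to 0.
  mid≢1 : ∀ {k m} → 1 ℕ.≤ k → k ℕ.≤ n → pos (+ k) + 1ℤ ≡ m → m ≢ 1ℤ
  mid≢1 1≤k k≤n e m≡1 = pos≢0 (numbered∈ 1≤k k≤n) (+1-cancel (trans e m≡1))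

  negative≡-∣∣ : ∀ {m} → m < 0ℤ → m ≡ - + ∣ m ∣
  negative≡-∣∣ { -[1+ _ ]} _ = refl
  negative≡-∣∣ {+ _} (+<+ ())

  negative⇒1≤∣∣ : ∀ {m} → m < 0ℤ → 1 ℕ.≤ ∣ m ∣
  negative⇒1≤∣∣ { -[1+ _ ]} _ = s≤s z≤n
  negative⇒1≤∣∣ {+ _} (+<+ ())

  drawing-correct : ∀ {A m} (s : Shape A m) → Draw A ∣ m ∣ (drawing s)
  drawing-correct {A} (ord {p} {q} {m} 1≤p p<q q≤n eq ep clear) =
    refl , tt , strand-fits (∣ m ∣) numbered eq clear (track-numbered-bot {m} ep) ∷ [] , [] ∷ []
  drawing-correct (orb {p} 1≤p p≤n e clear) =
    refl , tt , strand-fits 0 axisCenter e clear (track-0 (λ ()) (λ ())) ∷ [] , [] ∷ []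
  drawing-correct (lng {l} {r} {m} 1≤l l≤n 1≤r r≤n el er m<0 clear clear′) =
      refl , negative⇒1≤∣∣ m<0
    , strand-fits (∣ m ∣) axisLeft el clear (trans (track-0 m≢1 -m≢1) (negative≡-∣∣ m<0))
      ∷ strand-fits (∣ m ∣) axisRight er clear′ (trans (track-0 -m≢1 (m≢1 ∘ trans (sym (ℤ.neg-involutive m))))
                                 (trans (cong -_ (negative≡-∣∣ m<0)) (ℤ.neg-involutive (+ ∣ m ∣)))) ∷ []
    , (tracks-disjoint {m} { - m}
        {strand l 0 (seg m 0 l) axisLeft} {strand r 0 (seg (- m) 0 r) axisRight}
        (λ e → ℤ.<⇒≢ m<0 (i≡-i⇒i≡0 e)) ∷ []) ∷ [] ∷ []
    where
    m≢1 = mid≢1 1≤l l≤n el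
    -m≢1 = mid≢1 1≤r r≤n er

  -- The strands of a long arc have midpoints `m` and `- m`. Recording the midpoint up to sign
  -- treats all pairs of strands at once, and on the axis its absolute value is the radius.
  Tracked : ℤ → DStrand → Set
  Tracked m (st , f) = ∃ λ k → ∣ k ∣ ≡ ∣ m ∣ × f ≡ track k × (IsAxis (Strand.kind st) → track k 0 ≡ k)

  drawing-tracked : ∀ {A m} (s : Shape A m) → All (Tracked m) (drawing s)
  drawing-tracked (ord {m = m} _ _ _ _ _ _) = (m , refl , refl , λ ()) ∷ []
  drawing-tracked (orb _ _ _ _) = (0ℤ , refl , refl , λ _ → track-0 (λ ()) (λ ())) ∷ []
  drawing-tracked (lng {m = m} 1≤l l≤n 1≤r r≤n el er _ _ _) =
      (m , refl , refl , λ _ → track-0 m≢1 -m≢1)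
    ∷ (- m , ℤ.∣-i∣≡∣i∣ m , refl , λ _ → track-0 -m≢1 (m≢1 ∘ trans (sym (ℤ.neg-involutive m)))) ∷ []
    where
    m≢1 = mid≢1 1≤l l≤n el
    -m≢1 = mid≢1 1≤r r≤n er

  Shape-noncrossing : ∀ {A B m m′} → Shape A m → Shape B m′ → ∣ m ∣ ≢ ∣ m′ ∣ → NonCrossing A B
  Shape-noncrossing {m = m} {m′} s t ne =
      ∣ m ∣ , drawing s , ∣ m′ ∣ , drawing t , drawing-correct s , drawing-correct t
    , All.map (λ {x} p → All.map (λ {y} → apart {x} {y} p) (drawing-tracked t)) (drawing-tracked s)
    where
    apart : ∀ {x y} → Tracked m x → Tracked m′ y → Disj x y × AxisOK x y
    apart {st , _} {st′ , _} (k , ek , refl , ax) (k′ , ek′ , refl , ax′) =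
        tracks-disjoint {k} {k′} {st} {st′} (λ e → ne (trans (sym ek) (trans (cong ∣_∣ e) ek′)))
      , λ i j e → ne (trans (trans (sym ek) (cong ∣_∣ (sym (ax i)))) (trans e (trans (cong ∣_∣ (ax′ j)) ek′)))

  Shape-valid : ∀ {A m} → Shape A m → ValidArc n A
  Shape-valid (ord {p} {q} {m} 1≤p p<q q≤n _ _ _) = 1≤p , p<q , q≤n , length-between (sideOf m) p q
  Shape-valid (orb {p} 1≤p p≤n _ _) = 1≤p , p≤n , length-between (sideOf 0ℤ) 0 p
  Shape-valid s@(lng {l} {r} {m} 1≤l l≤n 1≤r r≤n el er m<0 _ _) =
      1≤l , l≤n , 1≤r , r≤n
    , (λ { refl → ℤ.<⇒≢ m<0 (i≡-i⇒i≡0 (trans (sym el) er)) })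
    , length-between (sideOf m) 0 l , length-between (sideOf (- m)) 0 r
    , ∣ m ∣ , drawing s , drawing-correct s

  -- An endpoint determines the midpoint: a descent from `v` sits just after `v`, and in
  -- `upEnds-mid` a descent to `v` sits just before it. Hence arcs with different midpoints up to
  -- sign share no endpoint in the same direction.
  downEnds-mid : ∀ {A m} → Shape A m → ∀ {v} → v ∈ downEnds A → ∣ pos (+ v) + 1ℤ ∣ ≡ ∣ m ∣
  downEnds-mid (ord _ _ _ eq _ _) (here refl) = cong ∣_∣ eq
  downEnds-mid (orb _ _ e _) (here refl) = cong ∣_∣ e
  downEnds-mid (lng _ _ _ _ el _ _ _ _) (here refl) = cong ∣_∣ el
  downEnds-mid (lng {m = m} _ _ _ _ _ er _ _ _) (there (here refl)) = trans (cong ∣_∣ er) (ℤ.∣-i∣≡∣i∣ m)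

  upEnds-mid : ∀ {A m} → Shape A m → ∀ {v} → v ∈ upEnds A → ∣ pos (+ v) + - 1ℤ ∣ ≡ ∣ m ∣
  upEnds-mid (ord {m = m} _ _ _ _ ep _) (here refl) = cong ∣_∣ (trans (cong (_+ - 1ℤ) ep) (lem m))
    where
    lem : ∀ i → i + 1ℤ + - 1ℤ ≡ i
    lem = solve-∀

  Shape-ends : ∀ {A B m m′} → Shape A m → Shape B m′ → ∣ m ∣ ≢ ∣ m′ ∣ → EndsOK A B
  Shape-ends s t ne =
      (λ x x∈ x∈′ → ne (trans (sym (downEnds-mid s x∈)) (downEnds-mid t x∈′)))
    , (λ x x∈ x∈′ → ne (trans (sym (upEnds-mid s x∈)) (upEnds-mid t x∈′)))

-- Descents and their folded images

turn : SArc → SArc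
turn α = sarc (- bot α) (- top α) λ v → flipSide (side α (- v))

i<-i⇒i<0 : ∀ {i} → i < - i → i < 0ℤ
i<-i⇒i<0 {+ zero} (+<+ ())
i<-i⇒i<0 {+[1+ _ ]} ()
i<-i⇒i<0 { -[1+ _ ]} _ = -<+

∣∣-bounded : ∀ {n b v t} → ∣ b ∣ ℕ.≤ n → ∣ t ∣ ℕ.≤ n → b ≤ v → v ≤ t → ∣ v ∣ ℕ.≤ n
∣∣-bounded {v = + _}      _  ≤n _         (+≤+ v≤t) = ℕ.≤-trans v≤t ≤n
∣∣-bounded {v = -[1+ _ ]} ≤n _  (-≤- v≤b) _         = ℕ.≤-trans (s≤s v≤b) ≤n

T⇒≡true : ∀ {x} → T x → x ≡ true
T⇒≡true {true} _ = refl

¬T⇒≡false : ∀ {x} → ¬ T x → x ≡ false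
¬T⇒≡false {true}  ¬t = ⊥-elim (¬t tt)
¬T⇒≡false {false} _  = refl

-- The last case distinction of `φ` with its tests as variables, so that `pick` can match on a test
-- while keeping its equation.
choose : Bool → Bool → BArc → BArc → BArc → BArc
choose e u o x y = if e then o else (if u then x else y)

module Folding {n : ℕ} {π : List ℤ} (sp : IsSignedPerm n π) where
  open Drawing sp public

  record DescentAt (α : SArc) (m : ℤ) : Set where
    field
      top∈    : top α ∈ word
      bot∈    : bot α ∈ word
      descent : bot α < top α
      top-mid : pos (top α) + 1ℤ ≡ m
      bot-mid : pos (bot α) ≡ m + 1ℤ
      sided   : ∀ {v} → v ∈ word → Inside α v →
                (side α v ≡ R × pos v + 1ℤ < m) ⊎ (side α v ≡ L × m + 1ℤ < pos v)

  open DescentAt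

  -- Stated for any arc agreeing with the half-turn of `α` at nonzero labels, because it serves both
  -- `turn` and the other lift, and the latter may differ at 0.
  DescentAt-turn : ∀ {α β m} → top β ≡ - bot α → bot β ≡ - top α →
    (∀ v → v ≢ 0ℤ → side β (- v) ≡ flipSide (side α v)) → DescentAt α m → DescentAt β (- m)
  DescentAt-turn {α} {β} {m} refl refl sd d = record
    { top∈ = ∈-word-neg (bot∈ d)
    ; bot∈ = ∈-word-neg (top∈ d)
    ; descent = ℤ.neg-mono-< (descent d)
    ; top-mid = trans (cong (_+ 1ℤ) (trans (pos-neg (bot α)) (cong -_ (bot-mid d)))) (lem₁ m)
    ; bot-mid = trans (pos-neg (top α)) (trans (lem₂ (pos (top α))) (cong (λ i → - i + 1ℤ) (top-mid d)))
    ; sided = λ {v} v∈ ins → subst Sided (ℤ.neg-involutive v)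
        (flipped (- v) (proj₁ (∈-word⁻ (∈-word-neg v∈))) (sided d (∈-word-neg v∈) (unturn v ins)))
    }
    where
    lem₁ : ∀ i → - (i + 1ℤ) + 1ℤ ≡ - i
    lem₁ = solve-∀
    lem₂ : ∀ i → - i ≡ - (i + 1ℤ) + 1ℤ
    lem₂ = solve-∀
    Sided : ℤ → Set
    Sided v = (side β v ≡ R × pos v + 1ℤ < - m) ⊎ (side β v ≡ L × - m + 1ℤ < pos v)
    unturn : ∀ v → Inside β v → Inside α (- v)
    unturn v (b<v , v<t) = subst (_< - v) (ℤ.neg-involutive (bot α)) (ℤ.neg-mono-< v<t)
                         , subst (- v <_) (ℤ.neg-involutive (top α)) (ℤ.neg-mono-< b<v)
    flipped : ∀ u → u ≢ 0ℤ →
      (side α u ≡ R × pos u + 1ℤ < m) ⊎ (side α u ≡ L × m + 1ℤ < pos u) → Sided (- u)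
    flipped u u≢0 (inj₁ (s≡R , lt)) = inj₂
      ( trans (sd u u≢0) (cong flipSide s≡R)
      , subst (- m + 1ℤ <_) (trans (lem₁ (pos u)) (sym (pos-neg u))) (ℤ.+-monoˡ-< 1ℤ (ℤ.neg-mono-< lt)))
    flipped u u≢0 (inj₂ (s≡L , lt)) = inj₁
      ( trans (sd u u≢0) (cong flipSide s≡L)
      , subst₂ _<_ (cong (_+ 1ℤ) (sym (pos-neg u))) (lem₁ m) (ℤ.+-monoˡ-< 1ℤ (ℤ.neg-mono-< lt)))

  turn-descent : ∀ {α m} → DescentAt α m → DescentAt (turn α) (- m)
  turn-descent {α} = DescentAt-turn {α} {turn α} refl refl
    λ v _ → cong (flipSide ∘ side α) (ℤ.neg-involutive v)

  lift-descent : ∀ i {A m} → DescentAt (lift i A) m → DescentAt (lift (not i) A) (- m)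
  lift-descent i {A} = DescentAt-turn {lift i A} {lift (not i) A}
    (lift-not-top i A) (lift-not-bot i A) (lift-not-side i A)

  inside∈ : ∀ {α m v} → DescentAt α m → v ≢ 0ℤ → Inside α v → v ∈ word
  inside∈ d v≢0 (b<v , v<t) = ∈-word⁺ v≢0
    (∣∣-bounded (proj₂ (∈-word⁻ (bot∈ d))) (proj₂ (∈-word⁻ (top∈ d))) (ℤ.<⇒≤ b<v) (ℤ.<⇒≤ v<t))

  module _ {α m} (d : DescentAt α m) {b t} (b≤ : bot α ≤ + b) (≤t : + t ≤ top α) where
    private
      look : ∀ {h} → b ℕ.< h → h ℕ.< t →
        (side α (+ h) ≡ R × pos (+ h) + 1ℤ < m) ⊎ (side α (+ h) ≡ L × m + 1ℤ < pos (+ h))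
      look b<h h<t = sided d (inside∈ d (+≢0 (ℕ.≤-trans (s≤s z≤n) b<h)) ins) ins
        where ins = ℤ.≤-<-trans b≤ (+<+ b<h) , ℤ.<-≤-trans (+<+ h<t) ≤t

    descent-clear : Clear m b t
    descent-clear h b<h h<t with look b<h h<t
    ... | inj₁ (_ , lt) = inj₁ lt
    ... | inj₂ (_ , lt) = inj₂ lt

    descent-seg : map (λ h → side α (+ h)) (between b t) ≡ seg m b t
    descent-seg = List.map-cong-local (All.tabulate λ {h} h∈ →
      let (b<h , h<t) = ∈-between⁻ h∈ in agree h (look b<h h<t))
      where
      agree : ∀ h → (side α (+ h) ≡ R × pos (+ h) + 1ℤ < m) ⊎ (side α (+ h) ≡ L × m + 1ℤ < pos (+ h)) →
        side α (+ h) ≡ sideOf m h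
      agree h (inj₁ (s≡R , lt)) = trans s≡R (sym (sideOf-R {m} {h} lt))
      agree h (inj₂ (s≡L , lt)) = trans s≡L (sym (sideOf-L {m} {h} lt))

  -- `φ` identifies opposite arcs, so the midpoint of a descent agrees with that of the shape of its
  -- image only up to sign.
  Folded : BArc → ℤ → Set
  Folded A m = ∃ λ k → Shape A k × (k ≡ m ⊎ k ≡ - m)

  Folded-∣∣ : ∀ {A m} → (f : Folded A m) → ∣ proj₁ f ∣ ≡ ∣ m ∣
  Folded-∣∣ (_ , _ , inj₁ e)         = cong ∣_∣ e
  Folded-∣∣ {m = m} (_ , _ , inj₂ e) = trans (cong ∣_∣ e) (ℤ.∣-i∣≡∣i∣ m)

  Folded-unique : ∀ {A B m} → Folded A m → Folded B m → A ≡ B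
  Folded-unique f g = Shape-unique (proj₁ (proj₂ f)) (proj₁ (proj₂ g)) (trans (Folded-∣∣ f) (sym (Folded-∣∣ g)))

  fold-upper : ∀ {a b s m} → DescentAt (sarc +[1+ a ] +[1+ b ] s) m →
    Shape (φ (sarc +[1+ a ] +[1+ b ] s)) m
  fold-upper {a} {b} {m = m} d =
    subst (λ l → Shape (ordinary (suc b) (suc a) l) m) (sym (descent-seg d ℤ.≤-refl ℤ.≤-refl))
    (ord (s≤s z≤n) (ℤ.drop‿+<+ (descent d)) (proj₂ (∈-word⁻ (top∈ d))) (top-mid d) (bot-mid d)
      (descent-clear d ℤ.≤-refl ℤ.≤-refl))

  module _ {a b s m} (d : DescentAt (sarc +[1+ a ] -[1+ b ] s) m) where
    private
      α = sarc +[1+ a ] -[1+ b ] s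
      d′ : DescentAt (turn α) (- m)
      d′ = turn-descent d
      upper = map (λ h → s (+ h)) (between 0 (suc a))
      lower = map (λ h → flipSide (s (- (+ h)))) (between 0 (suc b))
      upper≡ : upper ≡ seg m 0 (suc a)
      upper≡ = descent-seg d -≤+ ℤ.≤-refl
      lower≡ : lower ≡ seg (- m) 0 (suc b)
      lower≡ = descent-seg d′ -≤+ ℤ.≤-refl
      upperClear : Clear m 0 (suc a)
      upperClear = descent-clear d -≤+ ℤ.≤-refl
      lowerClear : Clear (- m) 0 (suc b)
      lowerClear = descent-clear d′ -≤+ ℤ.≤-refl
      a≤n = proj₂ (∈-word⁻ (top∈ d))
      b≤n = proj₂ (∈-word⁻ (top∈ d′))

      mid-right : m < 0ℤ → Folded (long (suc a) (suc b) upper lower) m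
      mid-right m<0 = m , subst₂ (λ x y → Shape (long (suc a) (suc b) x y) m) (sym upper≡) (sym lower≡)
        (lng (s≤s z≤n) a≤n (s≤s z≤n) b≤n (top-mid d) (top-mid d′) m<0 upperClear lowerClear) , inj₁ refl

      mid-left : - m < 0ℤ → Folded (long (suc b) (suc a) lower upper) m
      mid-left -m<0 = - m , subst₂ (λ x y → Shape (long (suc b) (suc a) x y) (- m))
        (sym lower≡) (trans (cong (λ k → seg k 0 (suc a)) (ℤ.neg-involutive m)) (sym upper≡))
        (lng (s≤s z≤n) b≤n (s≤s z≤n) a≤n (top-mid d′) (trans (top-mid d) (sym (ℤ.neg-involutive m))) -m<0
          lowerClear (subst (λ k → Clear k 0 (suc a)) (sym (ℤ.neg-involutive m)) upperClear)) , inj₂ refl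

      centred : a ≡ b → Folded (orbifold (suc a) upper) m
      centred refl with i≡-i⇒i≡0 (trans (sym (top-mid d)) (top-mid d′))
      ... | refl = 0ℤ , subst (λ l → Shape (orbifold (suc a) l) 0ℤ) (sym upper≡)
                     (orb (s≤s z≤n) a≤n (top-mid d) upperClear) , inj₁ refl

      i+1<j+1⇒ : ∀ {i j} → i + 1ℤ < j + 1ℤ → i < j
      i+1<j+1⇒ {i} {j} lt = ℤ.≰⇒> λ j≤i → ℤ.<⇒≱ lt (ℤ.+-monoˡ-≤ 1ℤ j≤i)

      -- The piece on the left is told by the height where the shorter piece ends.
      by-sign : (v : ℤ) → (pos v ≡ - (m + 1ℤ)) ⊎ (pos v ≡ - (m - 1ℤ)) →
        (s v ≡ R × pos v + 1ℤ < m) ⊎ (s v ≡ L × m + 1ℤ < pos v) →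
        (s v ≡ L × m < 0ℤ) ⊎ (s v ≡ R × - m < 0ℤ)
      by-sign v at (inj₁ (s≡R , lt)) = inj₂ (s≡R , i<-i⇒i<0 (subst (- m <_) (sym (ℤ.neg-involutive m)) (bound at)))
        where
        lem₁ : ∀ i → - (i + 1ℤ) + 1ℤ ≡ - i
        lem₁ = solve-∀
        lem₂ : ∀ i → - (i - 1ℤ) + 1ℤ ≡ - i + + 2
        lem₂ = solve-∀
        bound : (pos v ≡ - (m + 1ℤ)) ⊎ (pos v ≡ - (m - 1ℤ)) → - m < m
        bound (inj₁ e) = subst (_< m) (trans (cong (_+ 1ℤ) e) (lem₁ m)) lt
        bound (inj₂ e) = ℤ.≤-<-trans (ℤ.i≤i+j (- m) (+ 2)) (subst (_< m) (trans (cong (_+ 1ℤ) e) (lem₂ m)) lt)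
      by-sign v at (inj₂ (s≡L , lt)) = inj₁ (s≡L , i<-i⇒i<0 (bound at))
        where
        lem₁ : ∀ i → - (i - 1ℤ) ≡ - i + 1ℤ
        lem₁ = solve-∀
        lem₂ : ∀ i → - (i + 1ℤ) + + 2 ≡ - i + 1ℤ
        lem₂ = solve-∀
        bound : (pos v ≡ - (m + 1ℤ)) ⊎ (pos v ≡ - (m - 1ℤ)) → m < - m
        bound (inj₂ e) = i+1<j+1⇒ (subst (m + 1ℤ <_) (trans e (lem₁ m)) lt)
        bound (inj₁ e) = i+1<j+1⇒ (ℤ.<-≤-trans (subst (m + 1ℤ <_) e lt)
          (subst (- (m + 1ℤ) ≤_) (lem₂ m) (ℤ.i≤i+j (- (m + 1ℤ)) (+ 2))))

      top-pos : pos +[1+ a ] ≡ m - 1ℤ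
      top-pos = trans (lem (pos +[1+ a ])) (cong (_- 1ℤ) (top-mid d))
        where
        lem : ∀ i → i ≡ i + 1ℤ - 1ℤ
        lem = solve-∀

      -- The lower end of `α` has position `m + 1`, so its negative has position `- (m + 1)`; `α`
      -- passes that label, on a side governed by the sign of `m`. The same is done in `at-top` with
      -- the upper end, at position `m - 1`.
      at-bot : b ℕ.< a → (s +[1+ b ] ≡ L × m < 0ℤ) ⊎ (s +[1+ b ] ≡ R × - m < 0ℤ)
      at-bot b<a = by-sign +[1+ b ] (inj₁ (trans (pos-neg -[1+ b ]) (cong -_ (bot-mid d))))
        (sided d (∈-word⁺ (λ ()) b≤n) (-<+ , +<+ (s≤s b<a)))

      at-top : a ℕ.< b → (s -[1+ a ] ≡ L × m < 0ℤ) ⊎ (s -[1+ a ] ≡ R × - m < 0ℤ)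
      at-top a<b = by-sign -[1+ a ] (inj₂ (trans (pos-neg +[1+ a ]) (cong -_ top-pos)))
        (sided d (∈-word⁺ (λ ()) a≤n) (-<- a<b , -<+))

      decide : ∀ {t u x y} → (m < 0ℤ → Folded x m) → (- m < 0ℤ → Folded y m) →
        (t ≡ L × m < 0ℤ) ⊎ (t ≡ R × - m < 0ℤ) → u ≡ isL t → Folded (if u then x else y) m
      decide xf _ (inj₁ (refl , m<0)) refl  = xf m<0
      decide _ yf (inj₂ (refl , -m<0)) refl = yf -m<0

      pick : ∀ e u → (a ℕ.≡ᵇ b) ≡ e → (if b ℕ.<ᵇ a then isL (s +[1+ b ]) else isL (s -[1+ a ])) ≡ u →
        ∀ {o x y} → (a ≡ b → Folded o m) → (m < 0ℤ → Folded x m) → (- m < 0ℤ → Folded y m) →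
        Folded (choose e u o x y) m
      pick true _ e _ o _ _ = o (ℕ.≡ᵇ⇒≡ a b (subst T (sym e) tt))
      pick false u e eu {_} {x} {y} _ xf yf with ℕ.<-cmp a b
      ... | tri≈ _ a≡b _ = ⊥-elim (subst T e (ℕ.≡⇒≡ᵇ a b a≡b))
      ... | tri> _ _ b<a = decide xf yf (at-bot b<a) (trans (sym eu)
        (cong (λ c → if c then isL (s +[1+ b ]) else isL (s -[1+ a ])) (T⇒≡true (ℕ.<⇒<ᵇ b<a))))
      ... | tri< a<b _ _ = decide xf yf (at-top a<b) (trans (sym eu)
        (cong (λ c → if c then isL (s +[1+ b ]) else isL (s -[1+ a ]))
          (¬T⇒≡false (ℕ.<-asym a<b ∘ ℕ.<ᵇ⇒< b a))))

    fold-mixed : Folded (φ (sarc +[1+ a ] -[1+ b ] s)) m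
    fold-mixed = pick _ _ refl refl centred mid-right mid-left

  fold-descent : ∀ {α m} → DescentAt α m → Folded (φ α) m
  fold-descent {sarc (+ zero) _ _} d = contradiction refl (proj₁ (∈-word⁻ (top∈ d)))
  fold-descent {sarc _ (+ zero) _} d = contradiction refl (proj₁ (∈-word⁻ (bot∈ d)))
  fold-descent {sarc +[1+ a ] +[1+ b ] s} {m} d = m , fold-upper d , inj₁ refl
  fold-descent {sarc -[1+ a ] -[1+ b ] s} {m} d = - m , fold-upper (turn-descent d) , inj₂ refl
  fold-descent {sarc +[1+ a ] -[1+ b ] s} d = fold-mixed d
  fold-descent {sarc -[1+ a ] +[1+ b ] s} d = contradiction (descent d) λ ()

  private
    -- Orbifold arcs are included as the case `l = r` and `m = 0`, where the two pieces are
    -- half-turns of each other.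
    straddling : ∀ {l r m} → 1 ℕ.≤ l → l ℕ.≤ n → 1 ℕ.≤ r → r ℕ.≤ n →
      pos (+ l) + 1ℤ ≡ m → pos (+ r) + 1ℤ ≡ - m → Clear m 0 l → Clear (- m) 0 r →
      DescentAt (sarc (+ l) (- + r) (sides (seg m 0 l) (seg (- m) 0 r))) m
    straddling {l} {r} {m} 1≤l l≤n 1≤r r≤n el er clear clear′ = record
      { top∈ = numbered∈ 1≤l l≤n
      ; bot∈ = ∈-word-neg (numbered∈ 1≤r r≤n)
      ; descent = -+<+ 1≤r
      ; top-mid = el
      ; bot-mid = trans (pos-neg (+ r)) (trans (lem (pos (+ r))) (trans (cong (λ i → - i + 1ℤ) er)
                    (cong (_+ 1ℤ) (ℤ.neg-involutive m))))
      ; sided = λ {v} → on v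
      }
      where
      lem : ∀ i → - i ≡ - (i + 1ℤ) + 1ℤ
      lem = solve-∀
      α = sarc (+ l) (- + r) (sides (seg m 0 l) (seg (- m) 0 r))
      on : ∀ v → v ∈ word → Inside α v →
        (side α v ≡ R × pos v + 1ℤ < m) ⊎ (side α v ≡ L × m + 1ℤ < pos v)
      on (+ zero) v∈ _ = contradiction refl (proj₁ (∈-word⁻ v∈))
      on +[1+ h ] _ (_ , +<+ h<l) with clear (suc h) (s≤s z≤n) h<l | sideAt-between (sideOf m) {0} (s≤s z≤n) h<l
      ... | inj₁ lt | e = inj₁ (trans e (sideOf-R {m} {suc h} lt) , lt)
      ... | inj₂ lt | e = inj₂ (trans e (sideOf-L {m} {suc h} lt) , lt)
      on -[1+ h ] _ (b<v , _)
        with clear′ (suc h) (s≤s z≤n) h<r | sideAt-between (sideOf (- m)) {0} (s≤s z≤n) h<r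
        where
        h<r : suc h ℕ.< r
        h<r = ℤ.drop‿+<+ (ℤ.neg-cancel-< b<v)
      ... | inj₁ lt | e = inj₂ (cong flipSide (trans e (sideOf-R { - m} {suc h} lt)) ,
        subst₂ _<_ (cong (_+ 1ℤ) (ℤ.neg-involutive m)) (trans (sym (lem (pos +[1+ h ]))) (sym (pos-neg +[1+ h ])))
          (ℤ.+-monoˡ-< 1ℤ (ℤ.neg-mono-< lt)))
      ... | inj₂ lt | e = inj₁ (cong flipSide (trans e (sideOf-L { - m} {suc h} lt)) ,
        subst₂ _<_ (cong (_+ 1ℤ) (sym (pos-neg +[1+ h ]))) (trans (sym (lem (- m))) (ℤ.neg-involutive m))
          (ℤ.+-monoˡ-< 1ℤ (ℤ.neg-mono-< lt)))

  shape-lift : ∀ {A m} → Shape A m → DescentAt (lift false A) m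
  shape-lift (ord {p} {q} {m} 1≤p p<q q≤n eq ep clear) = record
    { top∈ = numbered∈ (ℕ.≤-trans 1≤p (ℕ.<⇒≤ p<q)) q≤n
    ; bot∈ = numbered∈ 1≤p (ℕ.≤-trans (ℕ.<⇒≤ p<q) q≤n)
    ; descent = +<+ p<q
    ; top-mid = eq
    ; bot-mid = ep
    ; sided = λ {v} → on v
    }
    where
    α = lift false (ordinary p q (seg m p q))
    on : ∀ v → v ∈ word → Inside α v →
      (side α v ≡ R × pos v + 1ℤ < m) ⊎ (side α v ≡ L × m + 1ℤ < pos v)
    on (+ h) _ (+<+ p<h , +<+ h<q) with clear h p<h h<q | sideAt-between (sideOf m) p<h h<q
    ... | inj₁ lt | e = inj₁ (trans e (sideOf-R {m} {h} lt) , lt)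
    ... | inj₂ lt | e = inj₂ (trans e (sideOf-L {m} {h} lt) , lt)
  shape-lift (orb 1≤p p≤n e clear) = straddling 1≤p p≤n 1≤p p≤n e e clear clear
  shape-lift (lng 1≤l l≤n 1≤r r≤n el er _ clear clear′) = straddling 1≤l l≤n 1≤r r≤n el er clear clear′

  -- The point is `m < 0ℤ` for a long arc: positions must agree with the order in which the drawn
  -- pieces reach the axis. At the height where the shorter piece ends, the side of the longer one
  -- either yields `m < - m` through the positions, or puts the right piece to the left of the left
  -- piece, an order that would persist down to the axis.
  lift-shape : ∀ {A m} → ValidArc n A → DescentAt (lift false A) m → Shape A m
  lift-shape {ordinary p q s} {m} (1≤p , p<q , q≤n , len) d =
    subst (λ l → Shape (ordinary p q l) m)
      (trans (sym (descent-seg d ℤ.≤-refl ℤ.≤-refl)) (between-sideAt s len))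
      (ord 1≤p p<q q≤n (top-mid d) (bot-mid d) (descent-clear d ℤ.≤-refl ℤ.≤-refl))
  lift-shape {orbifold p s} {m} (1≤p , p≤n , len) d
    with i≡-i⇒i≡0 (trans (sym (top-mid d)) (top-mid (lift-descent false {orbifold p s} d)))
  ... | refl = subst (λ l → Shape (orbifold p l) 0ℤ)
      (trans (sym (descent-seg d (-+≤+ p) ℤ.≤-refl)) (between-sideAt {0} {p} s len))
      (orb 1≤p p≤n (top-mid d) (descent-clear d (-+≤+ p) ℤ.≤-refl))
  lift-shape {long l r sl sr} {m} (1≤l , l≤n , 1≤r , r≤n , l≢r , lenl , lenr , ρ , E , dr) d =
    subst₂ (λ x y → Shape (long l r x y) m)
      (trans (sym (descent-seg d (-+≤+ r) ℤ.≤-refl)) (between-sideAt {0} {l} sl lenl))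
      (trans (sym (descent-seg d′ (-+≤+ l) ℤ.≤-refl)) (between-sideAt {0} {r} sr lenr))
      (lng 1≤l l≤n 1≤r r≤n (top-mid d) (top-mid d′) m<0
        (descent-clear d (-+≤+ r) ℤ.≤-refl) (descent-clear d′ (-+≤+ l) ℤ.≤-refl))
    where
    A = long l r sl sr
    d′ = lift-descent false {A} d
    open Curves (curves dr)
    m<0 : m < 0ℤ
    m<0 with ℕ.<-cmp l r
    ... | tri≈ _ l≡r _ = contradiction l≡r l≢r
    ... | tri< l<r _ _ = go (sided d′ (numbered∈ 1≤l l≤n) ins)
      where
      ins : Inside (lift true A) (+ l)
      ins = -+<+ 1≤l , +<+ l<r
      go : (side (lift true A) (+ l) ≡ R × pos (+ l) + 1ℤ < - m)
         ⊎ (side (lift true A) (+ l) ≡ L × - m + 1ℤ < pos (+ l)) → m < 0ℤ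
      go (inj₁ (_ , lt)) = i<-i⇒i<0 (subst (_< - m) (top-mid d) lt)
      go (inj₂ (s≡L , _)) = contradiction (pieces-ordered dr) (ℤ.<-asym
        (curves-kept (curves dr) (curves dr) true false (pieces-disjoint′ dr) {0} {l} z≤n
          z≤n z≤n (ℕ.<⇒≤ l<r) ℕ.≤-refl (ℤ.<⇒≢ (pieces-ordered dr) ∘ sym)
          (subst (curve true l <_) (sym (position-On false {+ l} (+≢0 1≤l) (inj₁ refl)))
            (position-L true {+ l} (+≢0 1≤l) (ins , s≡L)))))
    ... | tri> _ _ r<l = go (sided d (numbered∈ 1≤r r≤n) ins)
      where
      ins : Inside (lift false A) (+ r)
      ins = -+<+ 1≤r , +<+ r<l
      go : (side (lift false A) (+ r) ≡ R × pos (+ r) + 1ℤ < m)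
         ⊎ (side (lift false A) (+ r) ≡ L × m + 1ℤ < pos (+ r)) → m < 0ℤ
      go (inj₂ (_ , lt)) = i<-i⇒i<0 (subst (m <_) (top-mid d′)
        (ℤ.<-trans (ℤ.<-trans (i<i+1 m) lt) (i<i+1 (pos (+ r)))))
      go (inj₁ (s≡R , _)) = contradiction (pieces-ordered dr) (ℤ.<-asym
        (curves-kept (curves dr) (curves dr) true false (pieces-disjoint′ dr) {0} {r} z≤n
          z≤n z≤n ℕ.≤-refl (ℕ.<⇒≤ r<l) (ℤ.<⇒≢ (pieces-ordered dr) ∘ sym)
          (subst (_< curve false r) (sym (position-On true {+ r} (+≢0 1≤r) (inj₁ refl)))
            (position-R false {+ r} (+≢0 1≤r) (ins , s≡R)))))

  lift-folded : ∀ i {A m} → ValidArc n A → DescentAt (lift i A) m → Folded A m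
  lift-folded false {m = m} v d = m , lift-shape v d , inj₁ refl
  lift-folded true {A} {m} v d = - m , lift-shape v (lift-descent true {A} d) , inj₂ refl

  folded-lift : ∀ {A m} → Folded A m → ∃ λ i → DescentAt (lift i A) m
  folded-lift (_ , s , inj₁ refl) = false , shape-lift s
  folded-lift {A} {m} (_ , s , inj₂ refl) =
    true , subst (DescentAt (lift true A)) (ℤ.neg-involutive m) (lift-descent false {A} (shape-lift s))

  descent-at-split : ∀ p {x y q} → word ≡ p ++ x ∷ y ∷ q → y < x → DescentAt (descentArc x y p) (pos x + 1ℤ)
  descent-at-split p {x} {y} {q} e y<x = record
    { top∈ = x∈ ; bot∈ = y∈ ; descent = y<x ; top-mid = refl
    ; bot-mid = bm
    ; sided = λ v∈ ins → on v∈ ins (∈-split p (subst (_ ∈_) e v∈) (ℤ.<⇒≢ (proj₂ ins)) (ℤ.<⇒≢ (proj₁ ins) ∘ sym))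
    }
    where
    lem : ∀ i → i + + 2 ≡ i + 1ℤ + 1ℤ
    lem = solve-∀
    x∈ : x ∈ word
    x∈ = subst (x ∈_) (sym e) (∈-++⁺ʳ p (here refl))
    y∈ : y ∈ word
    y∈ = subst (y ∈_) (sym e) (∈-++⁺ʳ p (there (here refl)))
    bm : pos y ≡ pos x + 1ℤ + 1ℤ
    bm = trans (Linked-adjacent p (subst (Linked _) e word-linked)) (lem (pos x))
    gaps : AllPairs Gap (p ++ x ∷ y ∷ q)
    gaps = subst (AllPairs Gap) e word-gaps
    gaps′ : AllPairs Gap ((p ++ x ∷ []) ++ y ∷ q)
    gaps′ = subst (AllPairs Gap) (sym (List.++-assoc p (x ∷ []) (y ∷ q))) gaps
    on : ∀ {v} → v ∈ word → Inside (descentArc x y p) v → v ∈ p ⊎ v ∈ q →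
      (side (descentArc x y p) v ≡ R × pos v + 1ℤ < pos x + 1ℤ)
      ⊎ (side (descentArc x y p) v ≡ L × pos x + 1ℤ + 1ℤ < pos v)
    on {v} v∈ ins (inj₁ v∈p) = inj₁ (cong (λ c → if c then R else L) (memℤ-∈ v∈p)
      , ℤ.+-monoˡ-< 1ℤ (Gap⇒< {v} {x} (AllPairs-before p gaps v∈p)))
    on {v} v∈ ins (inj₂ v∈q) = inj₂ (cong (λ c → if c then R else L) (memℤ-∉ v∉p) , subst (_< pos v) bm y<v)
      where
      y<v : pos y < pos v
      y<v = Gap⇒< {y} {v} (AllPairs-after (p ++ x ∷ []) gaps′ v∈q)
      v∉p : v ∉ p
      v∉p v∈p = ℤ.<-asym y<v (Gap⇒< {v} {y} (AllPairs-before (p ++ x ∷ []) gaps′ (∈-++⁺ˡ v∈p)))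

  δ-descent : ∀ {α} → α ∈ δ π → ∃ λ m → DescentAt α m
  δ-descent α∈ with descents⁻ [] word α∈
  ... | p , x , y , q , e , y<x , refl = pos x + 1ℤ , descent-at-split p e y<x

  δ°-folded : ∀ {A} → A ∈ δ° π → ∃ λ m → Folded A m
  δ°-folded A∈ with ∈-map⁻ φ A∈
  ... | α , α∈ , refl = proj₁ (δ-descent α∈) , fold-descent (proj₂ (δ-descent α∈))

  δ°-at-split : ∀ p {x y q} → word ≡ p ++ x ∷ y ∷ q → y < x → ∃ λ A → A ∈ δ° π × Folded A (pos x + 1ℤ)
  δ°-at-split p {x} {y} {q} e y<x = φ (descentArc x y p)
    , ∈-map⁺ φ (subst (λ w → descentArc x y p ∈ descents [] w) (sym e) (descents⁺ [] p q y<x))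
    , fold-descent (descent-at-split p e y<x)

  δ°-diagram : NCDiagram n (δ° π)
  δ°-diagram = All.tabulate (λ A∈ → Shape-valid (proj₁ (proj₂ (proj₂ (δ°-folded A∈)))))
    , λ A B A∈ B∈ A≢B → pair (proj₂ (δ°-folded A∈)) (proj₂ (δ°-folded B∈)) A≢B
    where
    pair : ∀ {A B m m′} → Folded A m → Folded B m′ → A ≢ B → NonCrossing A B × EndsOK A B
    pair (k , s , _) (k′ , t , _) A≢B = Shape-noncrossing s t ne , Shape-ends s t ne
      where
      ne : ∣ k ∣ ≢ ∣ k′ ∣
      ne e = A≢B (Shape-unique s t e)

-- Lists sorted by an asymmetric relation

module _ {a} {A : Set a} where

  AllPairs-map-∈ : ∀ {R S : A → A → Set} {xs} → (∀ {x y} → x ∈ xs → y ∈ xs → R x y → S x y) →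
    AllPairs R xs → AllPairs S xs
  AllPairs-map-∈ f []         = []
  AllPairs-map-∈ f (rs ∷ rss) =
    All.tabulate (λ y∈ → f (here refl) (there y∈) (All.lookup rs y∈))
    ∷ AllPairs-map-∈ (λ x∈ y∈ → f (there x∈) (there y∈)) rss

  ++-cancel-length : ∀ (xs ys : List A) {us vs} → length xs ≡ length ys → xs ++ us ≡ ys ++ vs → us ≡ vs
  ++-cancel-length []       []       _ e = e
  ++-cancel-length (_ ∷ xs) (_ ∷ ys) l e = ++-cancel-length xs ys (ℕ.suc-injective l) (List.∷-injectiveʳ e)

  module _ {R : A → A → Set} (asym : ∀ {x y} → R x y → ¬ R y x) where

    sorted-unique : ∀ {xs ys} → AllPairs R xs → AllPairs R ys →
      (∀ {z} → z ∈ xs → z ∈ ys) → (∀ {z} → z ∈ ys → z ∈ xs) → xs ≡ ys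
    sorted-unique {[]} {[]} _ _ _ _ = refl
    sorted-unique {[]} {_ ∷ _} _ _ _ g with () ← g (here refl)
    sorted-unique {_ ∷ _} {[]} _ _ f _ with () ← f (here refl)
    sorted-unique {x ∷ xs} {y ∷ ys} (rs ∷ rss) (ts ∷ tss) f g with f (here refl) | g (here refl)
    ... | there x∈ | there y∈ = contradiction (All.lookup rs y∈) (asym (All.lookup ts x∈))
    ... | there x∈ | here refl = contradiction (All.lookup ts x∈) (asym (All.lookup ts x∈))
    ... | here refl | _ = cong (x ∷_) (sorted-unique rss tss (tail rs f) (tail ts g))
      where
      tail : ∀ {us vs} → All (R x) us → (∀ {z} → z ∈ x ∷ us → z ∈ x ∷ vs) → ∀ {z} → z ∈ us → z ∈ vs
      tail us f z∈ with f (there z∈)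
      ... | there z∈vs = z∈vs
      ... | here refl = contradiction (All.lookup us z∈) (asym (All.lookup us z∈))

    adjacent-split : ∀ {xs x y} → AllPairs R xs → x ∈ xs → y ∈ xs → R x y →
      (∀ {z} → z ∈ xs → R x z → ¬ R z y) → ∃₂ λ p q → xs ≡ p ++ x ∷ y ∷ q
    adjacent-split _ (here refl) (here refl) r _ = contradiction r (asym r)
    adjacent-split _ (here refl) (there (here refl)) _ _ = [] , _ , refl
    adjacent-split ((r ∷ _) ∷ ss ∷ _) (here refl) (there (there y∈)) _ none =
      contradiction (All.lookup ss y∈) (none (there (here refl)) r)
    adjacent-split (rs ∷ _) (there x∈) (here refl) r _ = contradiction r (asym (All.lookup rs x∈))
    adjacent-split {z ∷ _} (_ ∷ rss) (there x∈) (there y∈) r none with adjacent-split rss x∈ y∈ r (none ∘ there)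
    ... | p , q , e = z ∷ p , q , cong (z ∷_) e

-- Injectivity: reading the permutation off its diagram

module _ {D E : List BArc} (D⊆E : ∀ {A} → A ∈ D → A ∈ E) where
  open Inversions

  Chain-mono : ∀ {x y} → Chain D x y → Chain E x y
  Chain-mono [ nz , A , A∈ , inv ]     = [ nz , A , D⊆E A∈ , inv ]
  Chain-mono ((nz , A , A∈ , inv) ∷ c) = (nz , A , D⊆E A∈ , inv) ∷ Chain-mono c

module Recovery {n : ℕ} {π : List ℤ} (sp : IsSignedPerm n π) where
  open Folding sp
  open DescentAt
  open Inversions (δ° π)

  lift-descends : ∀ {A m} i → Folded A m → ∃ λ k → DescentAt (lift i A) k
  lift-descends {A} i f with folded-lift f | i
  ... | false , d | false = _ , d
  ... | true , d  | true  = _ , d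
  ... | false , d | true  = _ , lift-descent false {A} d
  ... | true , d  | false = _ , lift-descent true {A} d

  -- The gap in which the arc sits separates the two labels: with midpoint `m`, the label `x` is at
  -- or before `m - 1` and `y` is at or after `m + 1`.
  Step⇒pos< : ∀ {x y} → Step x y → pos x < pos y
  Step⇒pos< {x} {y} ((x≢0 , y≢0) , A , A∈ , i , _ , above , below)
    with lift-descends i (proj₂ (δ°-folded A∈))
  ... | m , d = ℤ.<-≤-trans (ℤ.<-≤-trans (i<i+1 (pos x)) (up above)) (ℤ.≤-trans (ℤ.<⇒≤ (i<i+1 m)) (down below))
    where
    up : x ≡ top (lift i A) ⊎ PassesR (lift i A) x → pos x + 1ℤ ≤ m
    up (inj₁ refl) = ℤ.≤-reflexive (top-mid d)
    up (inj₂ (ins , s≡R)) with sided d (inside∈ d x≢0 ins) ins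
    ... | inj₁ (_ , lt) = ℤ.<⇒≤ lt
    ... | inj₂ (s≡L , _) = ⊥-elim (L≢R s≡L s≡R)
    down : y ≡ bot (lift i A) ⊎ PassesL (lift i A) y → m + 1ℤ ≤ pos y
    down (inj₁ refl) = ℤ.≤-reflexive (sym (bot-mid d))
    down (inj₂ (ins , s≡L)) with sided d (inside∈ d y≢0 ins) ins
    ... | inj₂ (_ , lt) = ℤ.<⇒≤ lt
    ... | inj₁ (s≡R , _) = ⊥-elim (L≢R s≡L s≡R)

  Chain⇒pos< : ∀ {x y} → Chain x y → pos x < pos y
  Chain⇒pos< [ s ]   = Step⇒pos< s
  Chain⇒pos< (s ∷ c) = ℤ.<-trans (Step⇒pos< s) (Chain⇒pos< c)

  -- The arc of the descent from `c` to `d` passes right of the labels in its range listed before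
  -- `c`, and left of those listed after `d`.
  split-step : ∀ p {c d q x y} → word ≡ p ++ c ∷ d ∷ q → x ∈ word → y ∈ word →
    d ≤ y → y < x → x ≤ c → (x ≡ c ⊎ pos x < pos c) → (y ≡ d ⊎ pos d < pos y) → Step x y
  split-step p {c} {d} {q} {x} {y} e x∈ y∈ d≤y y<x x≤c xc yd
    with δ°-at-split p e (ℤ.≤-<-trans d≤y (ℤ.<-≤-trans y<x x≤c))
  ... | A , A∈ , f with folded-lift f
  ...   | i , α = (proj₁ (∈-word⁻ x∈) , proj₁ (∈-word⁻ y∈)) , A , A∈ , i , y<x , above xc , below yd
    where
    c∈ : c ∈ word
    c∈ = subst (c ∈_) (sym e) (∈-++⁺ʳ p (here refl))
    d∈ : d ∈ word
    d∈ = subst (d ∈_) (sym e) (∈-++⁺ʳ p (there (here refl)))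
    c≡top : c ≡ top (lift i A)
    c≡top = pos-injective c∈ (top∈ α) (+1-cancel (sym (top-mid α)))
    lem : ∀ i → i + + 2 ≡ i + 1ℤ + 1ℤ
    lem = solve-∀
    d≡bot : d ≡ bot (lift i A)
    d≡bot = pos-injective d∈ (bot∈ α)
      (trans (trans (Linked-adjacent p (subst (Linked _) e word-linked)) (lem (pos c))) (sym (bot-mid α)))
    above : x ≡ c ⊎ pos x < pos c → x ≡ top (lift i A) ⊎ PassesR (lift i A) x
    above (inj₁ x≡c) = inj₁ (trans x≡c c≡top)
    above (inj₂ px<pc) = inj₂ (ins , right (sided α x∈ ins))
      where
      ins : Inside (lift i A) x
      ins = subst (_< x) d≡bot (ℤ.≤-<-trans d≤y y<x)
          , subst (x <_) c≡top (ℤ.≤∧≢⇒< x≤c λ { refl → ℤ.<-irrefl refl px<pc })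
      right : _ → side (lift i A) x ≡ R
      right (inj₁ (s≡R , _)) = s≡R
      right (inj₂ (_ , lt)) = contradiction (ℤ.<-trans (i<i+1 _) (ℤ.<-trans (i<i+1 _) lt)) (ℤ.<-asym px<pc)
    below : y ≡ d ⊎ pos d < pos y → y ≡ bot (lift i A) ⊎ PassesL (lift i A) y
    below (inj₁ y≡d) = inj₁ (trans y≡d d≡bot)
    below (inj₂ pd<py) = inj₂ (ins , left (sided α y∈ ins))
      where
      ins : Inside (lift i A) y
      ins = subst (_< y) d≡bot (ℤ.≤∧≢⇒< d≤y λ { refl → ℤ.<-irrefl refl pd<py })
          , subst (y <_) c≡top (ℤ.<-≤-trans y<x x≤c)
      left : _ → side (lift i A) y ≡ L
      left (inj₂ (s≡L , _)) = s≡L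
      left (inj₁ (_ , lt)) = contradiction
        (ℤ.<-trans (i<i+1 (pos y)) (ℤ.<-trans lt
          (subst (_ <_) (trans (sym (bot-mid α)) (cong pos (sym d≡bot))) (i<i+1 _))))
        (ℤ.<-asym pd<py)

  -- Walk along the word from c to y, never leaving the values above the
  -- last inverted entry x; each drop below x is a step.
  walk : ∀ p c q {x y} → word ≡ p ++ c ∷ q → x ∈ word → y ∈ c ∷ q →
    x ≤ c → (x ≡ c ⊎ pos x < pos c) → y < x → Chain x y
  walk p c q e x∈ (here refl) x≤c _ y<x = contradiction y<x (ℤ.≤⇒≯ x≤c)
  walk p c (d ∷ q) {x} {y} e x∈ (there y∈) x≤c xc y<x = go (ℤ.<-cmp d y) (d <? x)
    where
    e′ : word ≡ (p ++ c ∷ []) ++ d ∷ q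
    e′ = trans e (sym (List.++-assoc p (c ∷ []) (d ∷ q)))
    d∈ : d ∈ word
    d∈ = subst (d ∈_) (sym e′) (∈-++⁺ʳ (p ++ c ∷ []) (here refl))
    y∈word : y ∈ word
    y∈word = subst (y ∈_) (sym e′) (∈-++⁺ʳ (p ++ c ∷ []) y∈)
    c<d : pos c < pos d
    c<d = Gap⇒< {c} {d} (AllPairs-after p (subst (AllPairs Gap) e word-gaps) (here refl))
    x<d : (x ≡ c ⊎ pos x < pos c) → pos x < pos d
    x<d (inj₁ refl) = c<d
    x<d (inj₂ lt)   = ℤ.<-trans lt c<d
    later : y ∈ d ∷ q → d ≢ y → pos d < pos y
    later (here refl) d≢y = contradiction refl d≢y
    later (there y∈) _ = Gap⇒< {d} {y} (AllPairs-after (p ++ c ∷ []) (subst (AllPairs Gap) e′ word-gaps) y∈)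
    go : Tri (d < y) (d ≡ y) (y < d) → Dec (d < x) → Chain x y
    go (tri≈ _ refl _) _ = [ split-step p e x∈ d∈ ℤ.≤-refl y<x x≤c xc (inj₁ refl) ]
    go (tri< d<y d≢y _) _ = [ split-step p e x∈ y∈word (ℤ.<⇒≤ d<y) y<x x≤c xc (inj₂ (later y∈ d≢y)) ]
    go (tri> _ _ y<d) (yes d<x) = split-step p e x∈ d∈ ℤ.≤-refl d<x x≤c xc (inj₁ refl)
      ∷ walk (p ++ c ∷ []) d q e′ d∈ y∈ ℤ.≤-refl (inj₁ refl) y<d
    go (tri> _ _ _) (no d≮x) = walk (p ++ c ∷ []) d q e′ x∈ y∈ (ℤ.≮⇒≥ d≮x) (inj₂ (x<d xc)) y<x

  pos<⇒◁ : ∀ {u v} → u ∈ word → v ∈ word → Gap u v → u ◁ v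
  pos<⇒◁ {u} {v} u∈ v∈ g with ℤ.<-cmp u v
  ... | tri< u<v _ _ = inj₁ (u<v , λ c → ℤ.<-asym (Gap⇒< {u} {v} g) (Chain⇒pos< c))
  ... | tri≈ _ refl _ = contradiction (Gap⇒< {u} {u} g) (ℤ.<-irrefl refl)
  ... | tri> _ _ v<u with ∈-∃++ u∈
  ...   | p , q , e with ∈-++⁻ p (subst (v ∈_) e v∈)
  ...     | inj₁ v∈p = contradiction (Gap⇒< {u} {v} g)
              (ℤ.<-asym (Gap⇒< {v} {u} (AllPairs-before p (subst (AllPairs Gap) e word-gaps) v∈p)))
  ...     | inj₂ v∈′ = inj₂ (v<u , walk p u q e u∈ v∈′ ℤ.≤-refl (inj₁ refl) v<u)

  word-sorted : AllPairs _◁_ word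
  word-sorted = AllPairs-map-∈ pos<⇒◁ word-gaps

-- The order `_◁_` depends only on the set of arcs, so both long words are sorted by the same order;
-- having the same entries, they coincide.
δ°-injective : ∀ {n π σ} → IsSignedPerm n π → IsSignedPerm n σ → δ° π ≈ₛ δ° σ → π ≡ σ
δ°-injective {n} {π} {σ} sp sq same = ++-cancel-length (reverse (map -_ π)) (reverse (map -_ σ))
  (trans (len π) (trans (proj₁ sp) (trans (sym (proj₁ sq)) (sym (len σ))))) words
  where
  open Inversions (δ° π)
  len : ∀ ρ → length (reverse (map -_ ρ)) ≡ length ρ
  len ρ = trans (List.length-reverse (map -_ ρ)) (List.length-map -_ ρ)
  -- Absence of a chain travels against an inclusion of diagrams and presence along it, so both
  -- inclusions enter.
  transfer : ∀ {u v} → Inversions._◁_ (δ° σ) u v → u ◁ v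
  transfer (inj₁ (u<v , ¬c)) = inj₁ (u<v , λ c → ¬c (Chain-mono (λ {A} → proj₁ (same A)) c))
  transfer (inj₂ (v<u , c))  = inj₂ (v<u , Chain-mono (λ {A} → proj₂ (same A)) c)
  words : longWord π ≡ longWord σ
  words = sorted-unique ◁-asym (Recovery.word-sorted sp) (AllPairs.map transfer (Recovery.word-sorted sq))
    (λ z∈ → let (z≢0 , ∣z∣≤n) = Word.∈-word⁻ sp z∈ in Word.∈-word⁺ sq z≢0 ∣z∣≤n)
    (λ z∈ → let (z≢0 , ∣z∣≤n) = Word.∈-word⁻ sq z∈ in Word.∈-word⁺ sp z≢0 ∣z∣≤n)

-- Surjectivity: the arcs of a noncrossing diagram are the descents

module Sorted {n : ℕ} {D : List BArc} (nc : NCDiagram n D) {π : List ℤ} (sp : IsSignedPerm n π)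
  (word-◁ : AllPairs (Inversions._◁_ D) (longWord π)) where
  open Inversions D
  open Noncrossing nc
  open Folding sp
  open DescentAt

  ◁⇒pos< : ∀ {u v} → u ∈ word → v ∈ word → u ◁ v → pos u < pos v
  ◁⇒pos< {u} {v} u∈ v∈ u◁v
    with AllPairs-connex (AllPairs.zip (word-◁ , word-gaps)) u∈ v∈ (λ { refl → ◁-asym u◁v u◁v })
  ... | inj₁ (_ , g)   = Gap⇒< {u} {v} g
  ... | inj₂ (v◁u , _) = contradiction v◁u (◁-asym u◁v)

  module _ {A} (A∈ : A ∈ D) (i : Bool) where
    private
      α = lift i A
      a = top α
      b = bot α
      a∈ : a ∈ word
      a∈ = ∈-word⁺ (proj₁ (proper A∈ i)) (lift-top≤ i A (valid A∈))
      b∈ : b ∈ word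
      b∈ = ∈-word⁺ (proj₁ (proj₂ (proper A∈ i))) (lift-bot≤ i A (valid A∈))

    lift-split : ∃₂ λ p q → word ≡ p ++ a ∷ b ∷ q
    lift-split = adjacent-split ◁-asym word-◁ a∈ b∈ (top◁bot A∈ i)
      (λ z∈ → nothing-between A∈ i (proj₁ (∈-word⁻ z∈)))

    lift-is-descent : DescentAt α (pos a + 1ℤ)
    lift-is-descent with lift-split
    ... | p , q , e = record
      { top∈ = a∈ ; bot∈ = b∈ ; descent = descent d ; top-mid = refl ; bot-mid = bot-mid d
      ; sided = λ {v} v∈ ins → by-side v∈ ins (side α v) refl }
      where
      d = descent-at-split p e (proj₂ (proj₂ (proper A∈ i)))
      by-side : ∀ {v} → v ∈ word → Inside α v → ∀ s → side α v ≡ s →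
        (side α v ≡ R × pos v + 1ℤ < pos a + 1ℤ) ⊎ (side α v ≡ L × pos a + 1ℤ + 1ℤ < pos v)
      by-side v∈ ins R eq = inj₁ (eq , ℤ.+-monoˡ-< 1ℤ (◁⇒pos< v∈ a∈ (right⇒◁top A∈ i (ins , eq))))
      by-side v∈ ins L eq = inj₂ (eq , subst (_< _) (bot-mid d)
        (◁⇒pos< b∈ v∈ (left⇒bot◁ A∈ i (proj₁ (∈-word⁻ v∈)) (ins , eq))))

    lift-is-folded : Folded A (pos a + 1ℤ)
    lift-is-folded = lift-folded i (valid A∈) lift-is-descent

  -- An intermediate entry of the chain would be listed strictly between `x` and `y`, where
  -- consecutive positions leave no room.
  Chain-adjacent⇒Step : ∀ {x y} → x ∈ word → y ∈ word → pos y ≡ pos x + + 2 → Chain x y → Step x y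
  Chain-adjacent⇒Step _ _ _ [ s ] = s
  Chain-adjacent⇒Step {x} {y} x∈ y∈ e (_∷_ {y = z} s@((_ , z≢0) , _) c) =
    contradiction (subst (pos z <_) e (◁⇒pos< z∈ y∈ (inj₂ (Chain⇒> c , c))))
      (ℤ.≤⇒≯ (<⇒Gap x∈ z∈ (◁⇒pos< x∈ z∈ (inj₂ (Step⇒> s , [ s ])))))
    where
    z∈ : z ∈ word
    z∈ = ∈-word⁺ z≢0 (∣∣-bounded (proj₂ (∈-word⁻ y∈)) (proj₂ (∈-word⁻ x∈))
           (ℤ.<⇒≤ (Chain⇒> c)) (ℤ.<⇒≤ (Step⇒> s)))

  D⊆δ° : ∀ {A} → A ∈ D → A ∈ δ° π
  D⊆δ° A∈ with lift-split A∈ false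
  ... | p , q , e with δ°-at-split p e (proj₂ (proj₂ (proper A∈ false)))
  ...   | B , B∈ , f with Folded-unique f (lift-is-folded A∈ false)
  ...     | refl = B∈

  -- Consecutive descending entries are joined by a chain, hence by a single step, and the arc
  -- making it must start at `x`. Its midpoint is then `pos x + 1ℤ`, which determines the arc.
  descent∈D : ∀ p {x y q} → word ≡ p ++ x ∷ y ∷ q → y < x → ∃ λ A → A ∈ D × Folded A (pos x + 1ℤ)
  descent∈D p {x} {y} {q} e y<x = go (chain x◁y)
    where
    x∈ : x ∈ word
    x∈ = subst (x ∈_) (sym e) (∈-++⁺ʳ p (here refl))
    y∈ : y ∈ word
    y∈ = subst (y ∈_) (sym e) (∈-++⁺ʳ p (there (here refl)))
    adjacent : pos y ≡ pos x + + 2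
    adjacent = Linked-adjacent p (subst (Linked _) e word-linked)
    x◁y : x ◁ y
    x◁y = AllPairs-after p (subst (AllPairs _◁_) e word-◁) (here refl)
    chain : x ◁ y → Chain x y
    chain (inj₁ (x<y , _)) = contradiction y<x (ℤ.<-asym x<y)
    chain (inj₂ (_ , c))   = c
    go : Chain x y → ∃ λ A → A ∈ D × Folded A (pos x + 1ℤ)
    go c with Chain-adjacent⇒Step x∈ y∈ adjacent c
    ... | (_ , y≢0) , A , A∈ , i , _ , above , below =
      A , A∈ , subst (λ z → Folded A (pos z + 1ℤ)) (sym (x≡a above)) (lift-is-folded A∈ i)
      where
      α = lift i A
      d = lift-is-descent A∈ i
      b≤y : y ≡ bot α ⊎ PassesL α y → pos (bot α) ≤ pos y
      b≤y (inj₁ refl) = ℤ.≤-refl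
      b≤y (inj₂ l)    = ℤ.<⇒≤ (◁⇒pos< (bot∈ d) y∈ (left⇒bot◁ A∈ i y≢0 l))
      x≡a : x ≡ top α ⊎ PassesR α x → x ≡ top α
      x≡a (inj₁ x≡t) = x≡t
      -- Passing right of `x` puts the top after `x`, hence at `y` or later, although it is listed
      -- before the bottom, which is at `y` or earlier.
      x≡a (inj₂ r)   = contradiction
        (ℤ.<-≤-trans (◁⇒pos< (top∈ d) (bot∈ d) (top◁bot A∈ i)) (ℤ.≤-trans (b≤y below) (ℤ.≤-reflexive adjacent)))
        (ℤ.≤⇒≯ (<⇒Gap x∈ (top∈ d) (◁⇒pos< x∈ (top∈ d) (right⇒◁top A∈ i r))))

  fold∈D : ∀ {α} → α ∈ δ π → φ α ∈ D
  fold∈D {α} α∈ = go (descents⁻ [] word α∈)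
    where
    go : (∃₂ λ p x → ∃₂ λ y q → word ≡ p ++ x ∷ y ∷ q × y < x × α ≡ descentArc x y p) → φ α ∈ D
    go (p , x , y , q , e , y<x , α≡) = subst (λ β → φ β ∈ D) (sym α≡) (from (descent∈D p e y<x))
      where
      from : (∃ λ A → A ∈ D × Folded A (pos x + 1ℤ)) → φ (descentArc x y p) ∈ D
      from (A , A∈ , f) = subst (_∈ D) (Folded-unique f (fold-descent (descent-at-split p e y<x))) A∈

  δ°⊆D : ∀ {B} → B ∈ δ° π → B ∈ D
  δ°⊆D B∈ with ∈-map⁻ φ B∈
  ... | α , α∈ , refl = fold∈D α∈

-- Sorting the labels into a signed permutation

module Construction (n : ℕ) (D : List BArc) where
  open Inversions D

  ∣∣≥1⇒≢0 : ∀ {v} → 1 ℕ.≤ ∣ v ∣ → v ≢ 0ℤ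
  ∣∣≥1⇒≢0 () refl

  insert : ∀ x {xs} → x ≢ 0ℤ → All (_≢ 0ℤ) xs → All (x ≢_) xs → AllPairs _◁_ xs →
    ∃ λ ys → ys ↭ x ∷ xs × AllPairs _◁_ ys
  insert x {[]} _ _ _ _ = x ∷ [] , ↭-refl , [] ∷ []
  insert x {y ∷ ys} x≢0 (y≢0 ∷ ys≢0) (x≢y ∷ x∉ys) (y◁ ∷ ◁s) with ◁-connex x≢y
  ... | inj₁ x◁y = x ∷ y ∷ ys , ↭-refl
    , (x◁y ∷ All.zipWith (λ (z≢0 , y◁z) → ◁-trans x≢0 y≢0 z≢0 x◁y y◁z) (ys≢0 , y◁)) ∷ y◁ ∷ ◁s
  ... | inj₂ y◁x with insert x x≢0 ys≢0 x∉ys ◁s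
  ...   | zs , zs↭ , ◁zs = y ∷ zs , ↭-trans (prep y zs↭) (swap y x ↭-refl)
    , Perm.All-resp-↭ (↭-sym zs↭) (y◁x ∷ y◁) ∷ ◁zs

  -- The second half of the long word has to contain the later one of `k` and `- k`; this is where
  -- the sign of each entry is decided.
  signed : ∀ {k} → 1 ℕ.≤ k → ∃ λ v → ∣ v ∣ ≡ k × (- v) ◁ v
  signed {suc k} _ with ◁-connex {+[1+ k ]} { -[1+ k ]} (λ ())
  ... | inj₁ +◁- = -[1+ k ] , refl , +◁-
  ... | inj₂ -◁+ = +[1+ k ] , refl , -◁+

  arrange : ∀ {ks} → All (1 ℕ.≤_) ks → Unique ks →
    ∃ λ π → map ∣_∣ π ↭ ks × AllPairs _◁_ π × All (λ v → (- v) ◁ v) π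
  arrange [] [] = [] , ↭-refl , [] , []
  arrange {k ∷ ks} (1≤k ∷ 1≤ks) (k∉ ∷ u) with signed 1≤k | arrange 1≤ks u
  ... | v , refl , -v◁v | π , π↭ , ◁π , -◁π
    with insert v (∣∣≥1⇒≢0 1≤k)
           (All.map ∣∣≥1⇒≢0 (All.map⁻ (Perm.All-resp-↭ (↭-sym π↭) 1≤ks)))
           (All.map (λ ne e → ne (cong ∣_∣ e)) (All.map⁻ (Perm.All-resp-↭ (↭-sym π↭) k∉))) ◁π
  ...   | ρ , ρ↭ , ◁ρ = ρ , ↭-trans (Perm.map⁺ ∣_∣ ρ↭) (prep _ π↭) , ◁ρ , Perm.All-resp-↭ (↭-sym ρ↭) (-v◁v ∷ -◁π)

  labels : List ℕ
  labels = map suc (upTo n)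

  arrangement : ∃ λ π → map ∣_∣ π ↭ labels × AllPairs _◁_ π × All (λ v → (- v) ◁ v) π
  arrangement = arrange (All.map⁺ (All.tabulate λ _ → s≤s z≤n))
    (Unique.map⁺ ℕ.suc-injective (Unique.upTo⁺ n))

  π : List ℤ
  π = proj₁ arrangement

  private
    π↭ : map ∣_∣ π ↭ labels
    π↭ = proj₁ (proj₂ arrangement)
    ◁π : AllPairs _◁_ π
    ◁π = proj₁ (proj₂ (proj₂ arrangement))
    -◁π : All (λ v → (- v) ◁ v) π
    -◁π = proj₂ (proj₂ (proj₂ arrangement))

    labels-range : All (λ k → 1 ℕ.≤ k × k ℕ.≤ n) labels
    labels-range = All.map⁺ (All.tabulate λ k∈ → s≤s z≤n , ∈-upTo⁻ k∈)

  π-signed : IsSignedPerm n π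
  π-signed =
      trans (sym (List.length-map ∣_∣ π)) (trans (Perm.↭-length π↭)
        (trans (List.length-map suc (upTo n)) (List.length-upTo n)))
    , All.map (λ (1≤ , ≤n) → ∣∣≥1⇒≢0 1≤ , ≤n) (All.map⁻ (Perm.All-resp-↭ (↭-sym π↭) labels-range))
    , Unique-resp-↭ (↭⇒↭ₛ (↭-sym π↭)) (Unique.map⁺ ℕ.suc-injective (Unique.upTo⁺ n))

  private
    mirror : ∀ {xs ys} → AllPairs _◁_ xs → AllPairs _◁_ ys →
      (∀ {x y} → x ∈ xs → y ∈ ys → (- x) ◁ y) → AllPairs _◁_ (map -_ xs ʳ++ ys)
    mirror [] ◁ys _ = ◁ys
    mirror {x ∷ xs} {ys} (x◁ ∷ ◁xs) ◁ys across =
      mirror ◁xs (All.tabulate (across (here refl)) ∷ ◁ys) λ where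
        x′∈ (here refl) → ◁-neg (All.lookup x◁ x′∈)
        x′∈ (there y∈)  → across (there x′∈) y∈

    ≢0 : ∀ {z} → z ∈ π → z ≢ 0ℤ
    ≢0 z∈ = proj₁ (All.lookup (proj₁ (proj₂ π-signed)) z∈)

    -- The centre is crossed by passing from a negative to its own positive: through `x` if `x`
    -- precedes `y`, and through `- y` if `y` precedes `x`.
    across : ∀ {x y} → x ∈ π → y ∈ π → (- x) ◁ y
    across {x} {y} x∈ y∈ with x ≟ y
    ... | yes refl = All.lookup -◁π x∈
    ... | no x≢y with AllPairs-connex ◁π x∈ y∈ x≢y
    ...   | inj₁ x◁y = ◁-trans (neg-≢0 (≢0 x∈)) (≢0 x∈) (≢0 y∈) (All.lookup -◁π x∈) x◁y
    ...   | inj₂ y◁x = ◁-trans (neg-≢0 (≢0 x∈)) (neg-≢0 (≢0 y∈)) (≢0 y∈) (◁-neg y◁x) (All.lookup -◁π y∈)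

  word-◁ : AllPairs _◁_ (longWord π)
  word-◁ = subst (AllPairs _◁_) (List.ʳ++-defn (map -_ π)) (mirror ◁π ◁π across)

theorem5p1 : (n : ℕ) →
    ((π : List ℤ) → IsSignedPerm n π → NCDiagram n (δ° π))
    × ((π σ : List ℤ) → IsSignedPerm n π → IsSignedPerm n σ →
    δ° π ≈ₛ δ° σ → π ≡ σ)
    × ((D : List BArc) → NCDiagram n D →
    ∃ (λ π → IsSignedPerm n π × (δ° π ≈ₛ D)))
theorem5p1 n =
    (λ π sp → Folding.δ°-diagram sp)
  , (λ π σ sp sq → δ°-injective sp sq)
  , λ D nc → let open Construction n D in
      let open Sorted nc π-signed word-◁ in
      π , π-signed , λ A → δ°⊆D , D⊆δ°
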